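{- For every integer $t\ge 3$, $$m(P_{2t})\le \frac{(2t)!}{2}-\left\lfloor \frac{t^2}{4}\right\rfloor (2t-2)!.$$ In particular, as $t\to\infty$, $$m(P_{2t})\le \left(\frac{7}{8}+o(1)\right)\frac{(2t)!}{2},$$ where $o(1)$ denotes a quantity tending to $0$ as $t\to\infty$.
   Context: $P_n$ denotes the path on $n$ vertices. For a graph $H$, the Ramsey number $r(H)$ is the minimum positive integer $n$ such that every red/blue edge-coloring of the complete graph $K_n$ contains a monochromatic copy of $H$. The threshold Ramsey multiplicity $m(H)$ is the minimum, over all red/blue edge-colorings of $K_{r(H)}$, of the total number of monochromatic copies of $H$ (the number of red copies plus the number of blue copies). A copy of $H$ is an (unlabelled) subgraph of the complete graph isomorphic to $H$; in particular a path and its reversal are the same copy. -}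

module Defs where

open import Data.Nat.Base using (ℕ; zero; suc; z≤n; s≤s; _≤_; _+_)
open import Data.Nat.Properties as ℕ using ()
open import Data.Fin.Base using (Fin; zero; suc; toℕ)
open import Data.Fin.Properties as Fin using (any?; all?)
open import Data.Fin.Subset using (Subset; _∈_)
open import Data.Fin.Subset.Properties using (_∈?_)
open import Data.Integer.Base using (+_)
open import Data.Rational.Base as ℚ using (ℚ; 0ℚ)
open import Data.List.Base as List
  using (List; []; _∷_; length; filter; deduplicate; cartesianProductWith; allFin)
open import Data.List.Properties using (filter-≐; length-tabulate)
open import Data.List.Membership.Propositional using (lose; find) renaming (_∈_ to _∈ˡ_)
open import Data.List.Membership.Propositional.Properties
  using (∈-cartesianProductWith⁺; ∈-allFin; ∈-filter⁺; ∈-filter⁻; ∈-deduplicate⁺; ∈-map⁺)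
open import Data.List.Relation.Unary.Any as Any using (Any; here; there)
open import Data.List.Relation.Unary.All as All using (All)
import Data.List.Relation.Unary.AllPairs as AllPairsˡ
open import Data.List.Relation.Unary.Unique.Propositional renaming (Unique to Uniqueˡ)
import Data.List.Relation.Unary.Unique.Propositional.Properties as Uniqueˡ
open import Data.Vec.Base as Vec using (Vec; []; _∷_; lookup; tabulate)
open import Data.Vec.Properties as Vec using (lookup∘tabulate; []=⇒lookup)
open import Data.Vec.Relation.Unary.AllPairs using (allPairs?)
open import Data.Vec.Relation.Unary.Unique.Propositional using (Unique)
import Data.Vec.Relation.Unary.Unique.Propositional.Properties as Unique
import Data.Bool.Properties as Bool
open import Data.Bool.Base using (true)
open import Data.Product using (∃; ∃-syntax; Σ; _×_; _,_; proj₁; proj₂)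
open import Data.Product.Properties using (≡-dec)
open import Data.Sum.Base using (_⊎_; inj₁; inj₂)
open import Data.Sum using (swap)
open import Function.Base using (_∘_; id; case_of_)
open import Relation.Nullary using (¬_; Dec; yes; no; does; ¬?; _×-dec_; _⊎-dec_; _→-dec_)
open import Relation.Nullary.Decidable using (map′; decidable-stable)
open import Relation.Nullary.Negation using (contradiction)
open import Relation.Unary using (Pred)
import Relation.Unary as Unary
open import Relation.Binary using (Rel; Decidable; DecidableEquality; Symmetric; Irreflexive)
open import Relation.Binary.PropositionalEquality
  using (_≡_; _≢_; refl; sym; trans; cong; cong₂; subst)
open import Level using (0ℓ)

record Graph : Set₁ where
  field
    order       : ℕ
    Adj         : Rel (Fin order) 0ℓ
    adj?        : Decidable Adj
    symmetric   : Symmetric Adj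
    irreflexive : Irreflexive _≡_ Adj

open Graph using (order)

path : ℕ → Graph
path n = record
  { order       = n
  ; Adj         = λ i j → suc (toℕ i) ≡ toℕ j ⊎ suc (toℕ j) ≡ toℕ i
  ; adj?        = λ i j → (suc (toℕ i) ℕ.≟ toℕ j) ⊎-dec (suc (toℕ j) ℕ.≟ toℕ i)
  ; symmetric   = swap
  ; irreflexive = λ { refl (inj₁ e) → ℕ.1+n≢n e ; refl (inj₂ e) → ℕ.1+n≢n e }
  }

data Colour : Set where
  red blue : Colour

_≟ᶜ_ : DecidableEquality Colour
red  ≟ᶜ red  = yes refl
red  ≟ᶜ blue = no λ ()
blue ≟ᶜ red  = no λ ()
blue ≟ᶜ blue = yes refl

-- A colouring of the edges of K_n.  The diagonal values are junk: no
-- subgraph considered below has loops.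
record Colouring (n : ℕ) : Set where
  field
    colour     : Fin n → Fin n → Colour
    colour-sym : ∀ i j → colour i j ≡ colour j i

open Colouring

-- A vertex set together with the neighbourhood of each vertex.
Subgraph : ℕ → Set
Subgraph n = Subset n × Vec (Subset n) n

_≟ˢ_ : ∀ {n} → DecidableEquality (Subgraph n)
_≟ˢ_ = ≡-dec (Vec.≡-dec Bool._≟_) (Vec.≡-dec (Vec.≡-dec Bool._≟_))

vectors : ∀ {A : Set} → List A → ∀ k → List (Vec A k)
vectors xs zero    = [] ∷ []
vectors xs (suc k) = cartesianProductWith _∷_ xs (vectors xs k)

unique? : ∀ {k n} → Unary.Decidable (Unique {A = Fin n} {k})
unique? = allPairs? (λ i j → ¬? (i Fin.≟ j))

-- Injections Fin k → Fin n, as vectors of values.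
injections : ∀ k n → List (Vec (Fin n) k)
injections k n = filter unique? (vectors (allFin n) k)

image : ∀ (H : Graph) {n} → Vec (Fin n) (order H) → Subgraph n
image H f =
  (tabulate λ i → does (any? λ u → lookup f u Fin.≟ i)) ,
  (tabulate λ i → tabulate λ j → does
    (any? λ u → any? λ v →
      Graph.adj? H u v ×-dec (lookup f u Fin.≟ i) ×-dec (lookup f v Fin.≟ j)))

-- The subgraphs of K_n isomorphic to H are the images of H under injections
-- of its vertices; injections with the same image give the same copy.
copies : Graph → ∀ n → List (Subgraph n)
copies H n = deduplicate _≟ˢ_ (List.map (image H) (injections (order H) n))

Monochromatic : ∀ {n} → Colouring n → Colour → Pred (Subgraph n) 0ℓ
Monochromatic c x (_ , nbhd) = ∀ i j → j ∈ lookup nbhd i → colour c i j ≡ x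

monochromatic? : ∀ {n} (c : Colouring n) x → Unary.Decidable (Monochromatic c x)
monochromatic? c x (_ , nbhd) =
  all? λ i → all? λ j → (j ∈? lookup nbhd i) →-dec (colour c i j ≟ᶜ x)

monoCount : Graph → ∀ {n} → Colouring n → Colour → ℕ
monoCount H {n} c x = length (filter (monochromatic? c x) (copies H n))

totalMonoCount : Graph → ∀ {n} → Colouring n → ℕ
totalMonoCount H c = monoCount H c red + monoCount H c blue

IsLeast : Pred ℕ 0ℓ → ℕ → Set
IsLeast P n = P n × (∀ k → P k → n ≤ k)

HasMonoCopy : Graph → ∀ {n} → Colouring n → Set
HasMonoCopy H {n} c = ∃[ S ] S ∈ˡ copies H n × ∃[ x ] Monochromatic c x S

Arrows : Graph → ℕ → Set
Arrows H n = ∀ (c : Colouring n) → HasMonoCopy H c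

IsRamseyNumber : Graph → ℕ → Set
IsRamseyNumber H = IsLeast λ n → 1 ≤ n × Arrows H n

IsMinMonoCount : Graph → ℕ → ℕ → Set
IsMinMonoCount H n = IsLeast λ m → ∃ λ (c : Colouring n) → totalMonoCount H c ≡ m

least : ∀ {P : Pred ℕ 0ℓ} → Unary.Decidable P → ∀ n → P n → ∃ (IsLeast P)
least P? n pn with P? 0
... | yes p0 = 0 , p0 , λ _ _ → z≤n
least P? zero    pn | no ¬p0 = contradiction pn ¬p0
least P? (suc n) pn | no ¬p0 with least (P? ∘ suc) n pn
... | m , pm , min = suc m , pm , λ { zero p0 → contradiction p0 ¬p0
                                    ; (suc k) pk → s≤s (min k pk) }

∈-vectors : ∀ {A : Set} {xs : List A} → (∀ x → x ∈ˡ xs) →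
            ∀ {k} (v : Vec A k) → v ∈ˡ vectors xs k
∈-vectors all []      = here refl
∈-vectors all (x ∷ v) = ∈-cartesianProductWith⁺ _∷_ (all x) (∈-vectors all v)

∈-colours : ∀ x → x ∈ˡ red ∷ blue ∷ []
∈-colours red  = here refl
∈-colours blue = there (here refl)

_≗ᶜ_ : ∀ {n} → Colouring n → Colouring n → Set
c ≗ᶜ d = ∀ i j → colour c i j ≡ colour d i j

module _ {n : ℕ} {P : Pred (Colouring n) 0ℓ}
         (P? : Unary.Decidable P)
         (P-resp : ∀ {c d} → c ≗ᶜ d → P c → P d) where

  private
    Matrix : Set
    Matrix = Vec (Vec Colour n) n

    entry : Matrix → Fin n → Fin n → Colour
    entry M i j = lookup (lookup M i) j

    Realises : Pred Matrix 0ℓ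
    Realises M = Σ (∀ i j → entry M i j ≡ entry M j i) λ s →
      P (record { colour = entry M ; colour-sym = s })

    realises? : Unary.Decidable Realises
    realises? M with all? (λ i → all? λ j → entry M i j ≟ᶜ entry M j i)
    ... | no ¬s = no (¬s ∘ proj₁)
    ... | yes s with P? record { colour = entry M ; colour-sym = s }
    ...   | yes p = yes (s , p)
    ...   | no ¬p = no λ (_ , p) → ¬p (P-resp (λ _ _ → refl) p)

    matrix : Colouring n → Matrix
    matrix c = tabulate λ i → tabulate (colour c i)

    entry-matrix : ∀ c i j → entry (matrix c) i j ≡ colour c i j
    entry-matrix c i j = trans (cong (λ r → lookup r j) (lookup∘tabulate _ i))
                           (lookup∘tabulate _ j)

    realised : ∀ c → P c → Realises (matrix c)
    realised c p =
      (λ i j → trans (entry-matrix c i j) (trans (colour-sym c i j) (sym (entry-matrix c j i)))) ,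
      P-resp (λ i j → sym (entry-matrix c i j)) p

  anyColouring? : Dec (∃ P)
  anyColouring? = map′
    (λ a → let _ , _ , _ , p = find {P = Realises} a in _ , p)
    (λ (c , p) → lose (∈-vectors (∈-vectors ∈-colours) (matrix c)) (realised c p))
    (Any.any? realises? (vectors (vectors (red ∷ blue ∷ []) n) n))

hasMonoCopy? : ∀ H {n} → Unary.Decidable (HasMonoCopy H {n})
hasMonoCopy? H c = map′ find (λ (_ , ∈cs , p) → lose ∈cs p)
  (Any.any? (λ S → map′ (λ { (inj₁ p) → red , p ; (inj₂ p) → blue , p })
                        (λ { (red , p) → inj₁ p ; (blue , p) → inj₂ p })
                        (monochromatic? c red S ⊎-dec monochromatic? c blue S))
            (copies H _))

hasMonoCopy-resp : ∀ H {n} {c d : Colouring n} → c ≗ᶜ d → HasMonoCopy H c → HasMonoCopy H d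
hasMonoCopy-resp H c≗d (S , S∈ , x , p) =
  S , S∈ , x , λ i j e → trans (sym (c≗d i j)) (p i j e)

arrows? : ∀ H → Unary.Decidable (Arrows H)
arrows? H n = map′
  (λ ∄ c → decidable-stable (hasMonoCopy? H c) λ ¬p → ∄ (c , ¬p))
  (λ all (c , ¬p) → ¬p (all c))
  (¬? (anyColouring? (λ c → ¬? (hasMonoCopy? H c))
    (λ {c} {d} c≗d ¬p p → ¬p (hasMonoCopy-resp H {c = d} {c} (λ i j → sym (c≗d i j)) p))))

monoCount-resp : ∀ H {n} {c d : Colouring n} → c ≗ᶜ d → ∀ x → monoCount H c x ≡ monoCount H d x
monoCount-resp H {n} {c} {d} c≗d x = cong length
  (filter-≐ (monochromatic? c x) (monochromatic? d x)
    ((λ p i j e → trans (sym (c≗d i j)) (p i j e)) , (λ p i j e → trans (c≗d i j) (p i j e)))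
    (copies H n))

totalMonoCount-resp : ∀ H {n} {c d : Colouring n} → c ≗ᶜ d → totalMonoCount H c ≡ totalMonoCount H d
totalMonoCount-resp H {c = c} {d} c≗d =
  cong₂ _+_ (monoCount-resp H {c = c} {d} c≗d red) (monoCount-resp H {c = c} {d} c≗d blue)

minMonoCount-exists : ∀ H n → ∃ (IsMinMonoCount H n)
minMonoCount-exists H n = least
  (λ m → anyColouring? (λ c → totalMonoCount H c ℕ.≟ m)
                       (λ {c} {d} c≗d e → trans (sym (totalMonoCount-resp H {c = c} {d} c≗d)) e))
  _ (record { colour = λ _ _ → red ; colour-sym = λ _ _ → refl } , refl)

-- Ramsey's theorem for cliques, by the usual recursion on the two clique sizes.

ramseyBound : ℕ → ℕ → ℕ
ramseyBound zero    b       = 0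
ramseyBound (suc a) zero    = 0
ramseyBound (suc a) (suc b) = suc (ramseyBound a (suc b) + ramseyBound (suc a) b)

module _ {n : ℕ} (c : Colouring n) where

  Clique : Colour → ℕ → List (Fin n) → Set
  Clique x k xs = Σ (Fin k → Fin n) λ f →
    (∀ i → f i ∈ˡ xs) × (∀ i j → i ≢ j → f i ≢ f j × colour c (f i) (f j) ≡ x)

  private
    Nbr : Colour → Fin n → Fin n → Set
    Nbr x v u = colour c v u ≡ x

    nbr? : ∀ x v → Unary.Decidable (Nbr x v)
    nbr? x v u = colour c v u ≟ᶜ x

    nbrs : Colour → Fin n → List (Fin n) → List (Fin n)
    nbrs x v = filter (nbr? x v)

    length-nbrs : ∀ v xs → length xs ≡ length (nbrs red v xs) + length (nbrs blue v xs)
    length-nbrs v []       = refl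
    length-nbrs v (u ∷ us) with colour c v u
    ... | red  = cong suc (length-nbrs v us)
    ... | blue = trans (cong suc (length-nbrs v us)) (sym (ℕ.+-suc _ _))

    empty : ∀ {x xs} → Clique x 0 xs
    empty = (λ ()) , (λ ()) , (λ ())

    weaken : ∀ {x k v y us} → Clique x k (nbrs y v us) → Clique x k (v ∷ us)
    weaken {v = v} {y} (f , ∈f , p) = f , (λ i → there (proj₁ (∈-filter⁻ (nbr? y v) (∈f i)))) , p

    extend : ∀ {x k v us} → All (v ≢_) us → Clique x k (nbrs x v us) → Clique x (suc k) (v ∷ us)
    extend {x} {k} {v} {us} v∉us (f , ∈f , p) = g , ∈g , q
      where
      f∈us : ∀ i → f i ∈ˡ us × Nbr x v (f i)
      f∈us i = ∈-filter⁻ (nbr? x v) (∈f i)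

      g : Fin (suc k) → Fin n
      g zero    = v
      g (suc i) = f i

      ∈g : ∀ i → g i ∈ˡ v ∷ us
      ∈g zero    = here refl
      ∈g (suc i) = there (proj₁ (f∈us i))

      v≢f : ∀ i → v ≢ f i
      v≢f i = All.lookup v∉us (proj₁ (f∈us i))

      q : ∀ i j → i ≢ j → g i ≢ g j × colour c (g i) (g j) ≡ x
      q zero    zero    0≢0 = contradiction refl 0≢0
      q zero    (suc j) _   = v≢f j , proj₂ (f∈us j)
      q (suc i) zero    _   = v≢f i ∘ sym , trans (colour-sym c _ _) (proj₂ (f∈us i))
      q (suc i) (suc j) i≢j = p i j (i≢j ∘ cong suc)

    split : ∀ {a b m k} → suc (a + b) ≤ suc (m + k) → a ≤ m ⊎ b ≤ k
    split {a} {b} {m} {k} (s≤s le) with a ℕ.≤? m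
    ... | yes a≤m = inj₁ a≤m
    ... | no  a≰m with b ℕ.≤? k
    ...   | yes b≤k = inj₂ b≤k
    ...   | no  b≰k = contradiction le
      (ℕ.<⇒≱ (ℕ.+-mono-< (ℕ.≰⇒> a≰m) (ℕ.≰⇒> b≰k)))

  cliqueRamsey : ∀ a b xs → Uniqueˡ xs → ramseyBound a b ≤ length xs →
                 Clique red a xs ⊎ Clique blue b xs
  cliqueRamsey zero    b       xs _ _ = inj₁ empty
  cliqueRamsey (suc a) zero    xs _ _ = inj₂ empty
  cliqueRamsey (suc a) (suc b) (v ∷ us) (v∉us AllPairsˡ.∷ uniq) le
    with split {ramseyBound a (suc b)} {ramseyBound (suc a) b} (subst (λ l → _ ≤ suc l) (length-nbrs v us) le)
  ... | inj₁ le′ with cliqueRamsey a (suc b) (nbrs red v us) (Uniqueˡ.filter⁺ (nbr? red v) uniq) le′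
  ...   | inj₁ K = inj₁ (extend v∉us K)
  ...   | inj₂ K = inj₂ (weaken K)
  cliqueRamsey (suc a) (suc b) (v ∷ us) (v∉us AllPairsˡ.∷ uniq) le
      | inj₂ le′ with cliqueRamsey (suc a) b (nbrs blue v us) (Uniqueˡ.filter⁺ (nbr? blue v) uniq) le′
  ...   | inj₁ K = inj₁ (weaken K)
  ...   | inj₂ K = inj₂ (extend v∉us K)

does⇒ : ∀ {A : Set} (a? : Dec A) → does a? ≡ true → A
does⇒ (yes a) _ = a

image-edge : ∀ H {n} (f : Vec (Fin n) (order H)) i j → j ∈ lookup (proj₂ (image H f)) i →
             ∃[ u ] ∃[ v ] Graph.Adj H u v × lookup f u ≡ i × lookup f v ≡ j
image-edge H f i j j∈ = does⇒ (any? _)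
  (trans (sym (lookup∘tabulate _ j))
    (trans (cong (λ r → lookup r j) (sym (lookup∘tabulate _ i))) ([]=⇒lookup j∈)))

clique⇒hasMonoCopy : ∀ H {n} (c : Colouring n) {x xs} → Clique c x (order H) xs → HasMonoCopy H c
clique⇒hasMonoCopy H {n} c {x} (f , _ , p) =
  image H fs ,
  ∈-deduplicate⁺ _≟ˢ_ (∈-map⁺ (image H) (∈-filter⁺ unique? (∈-vectors ∈-allFin fs) uniq)) ,
  x , mono
  where
  fs : Vec (Fin n) (order H)
  fs = tabulate f

  uniq : Unique fs
  uniq = Unique.tabulate⁺ λ {i} {j} e →
    decidable-stable (i Fin.≟ j) λ i≢j → proj₁ (p i j i≢j) e

  mono : Monochromatic c x (image H fs)
  mono i j j∈ with image-edge H fs i j j∈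
  ... | u , v , uv , refl , refl
    rewrite lookup∘tabulate f u | lookup∘tabulate f v =
    proj₂ (p u v λ u≡v → Graph.irreflexive H u≡v uv)

ramsey : ∀ H → Arrows H (suc (ramseyBound (order H) (order H)))
ramsey H c = case cliqueRamsey c k k (allFin n) (Uniqueˡ.allFin⁺ n) bound of λ where
    (inj₁ K) → clique⇒hasMonoCopy H c K
    (inj₂ K) → clique⇒hasMonoCopy H c K
  where
  k n : ℕ
  k = order H
  n = suc (ramseyBound k k)

  bound : ramseyBound k k ≤ length (allFin n)
  bound = subst (ramseyBound k k ≤_) (sym (length-tabulate {n = n} id)) (ℕ.n≤1+n _)

-- Abstract so that type checking never runs the two searches; the attached
-- IsLeast proofs determine the values.
abstract
  ramseyNumber : ∀ H → ∃ (IsRamseyNumber H)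
  ramseyNumber H = least (λ n → (1 ℕ.≤? n) ×-dec arrows? H n) _ (s≤s z≤n , ramsey H)

  minMonoCount : ∀ H n → ∃ (IsMinMonoCount H n)
  minMonoCount = minMonoCount-exists

r : Graph → ℕ
r H = proj₁ (ramseyNumber H)

m : Graph → ℕ
m H = proj₁ (minMonoCount H (r H))

ι : ℕ → ℚ
ι n = + n ℚ./ 1

-- Rational values lose nothing for an o(1) term in an inequality between
-- rationals.
TendsToZero : (ℕ → ℚ) → Set
TendsToZero o = ∀ ε → 0ℚ ℚ.< ε → ∃[ N ] ∀ t → N ≤ t → ℚ.∣ o t ∣ ℚ.< ε

{-# OPTIONS --safe #-}
-- Upper bound on r: let x₁ … xₖ be a monochromatic path, say red, with k < 2t,
-- in a colouring of K₃ₜ₋₁, and suppose that no outer vertex can be inserted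
-- into it.  Then every outer vertex is joined in blue to x₁, to xₖ and to one of
-- any two consecutive xᵢ.  Going through the disjoint pairs x₂x₃, x₄x₅, …, each
-- pair either extends a blue path that alternates between outer vertices and
-- the xᵢ, or yields an xᵢ joined in blue to all outer vertices still unused;
-- gluing along x₁ gives a blue path with more than k vertices.  So some
-- monochromatic path reaches 2t vertices, and r ≤ 3t - 1.
--
-- Colouring with few copies: a red clique on 2t vertices, a red clique on t - 1
-- further ones, all edges between them blue, and inside the first clique a blue
-- star with e = ⌊t/2⌋ edges.  A monochromatic P₂ₜ passes through the centre of
-- the star.  A red one has both its neighbours there outside the star; a blue
-- one alternates between the two cliques apart from one or two edges of the star.
-- Counting each path in one fixed direction gives at most
-- (2t)!/2 - e(t - e)(2t - 2)! of them, and the same bound holds for the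
-- restriction of the colouring to fewer vertices, so r ≥ 3t - 1 is never used.
-- Since 16e(t - e) ≥ 2t(2t - 1), the bound 7/8 holds with o = 0.
module Submission where

open import Defs
open import Data.Nat using (ℕ; _*_; _∸_; _≤_; _!) renaming (_/_ to _div_)
open import Data.Integer using (+_)
open import Data.Rational using (ℚ; _/_; _-_) renaming (_≤_ to _≤ℚ_; _+_ to _+ℚ_; _*_ to _*ℚ_)
open import Data.Product using (_×_; ∃-syntax)

open import Level using (0ℓ)
open import Data.Fin.Base
  using (Fin; zero; suc; toℕ; fromℕ; fromℕ<; opposite; inject₁; inject≤; splitAt; join)
open import Data.Fin.Properties
  using (_≟_; any?; toℕ<n; toℕ-fromℕ<; opposite-prop; opposite-involutive; join-splitAt; inject≤-injective)
import Data.Integer as ℤ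
import Data.Integer.Properties as ℤ
open import Data.List.Base using
  ( List; []; _∷_; [_]; _++_; _ʳ++_; length; map; concatMap; filter; take; replicate; upTo
  ; tabulate; allFin; reverse)
open import Data.List.Properties using
  ( ++-assoc; ++-identityʳ; length-++; length-take; length-tabulate; length-map; length-upTo
  ; length-ʳ++; take-[]; ʳ++-defn; ʳ++-ʳ++; reverse-involutive; reverse-map; map-injective)
open import Data.List.Membership.Propositional using (_∈_; find; lose)
open import Data.List.Membership.Propositional.Properties using
  ( ∈-∃++; ∈-allFin; ∈-++⁺ˡ; ∈-++⁺ʳ; ∈-filter⁺; ∈-filter⁻; ∈-deduplicate⁺; ∈-deduplicate⁻
  ; ∈-map⁺; ∈-map⁻; ∈-concatMap⁺; ∈-upTo⁺; ∈-upTo⁻; ∈-tabulate⁺)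
open import Data.List.Relation.Binary.Permutation.Propositional using
  (_↭_; prep; swap; ↭-refl; ↭-sym; ↭-trans; ↭-reflexive; ↭⇒↭ₛ; module PermutationReasoning)
open import Data.List.Relation.Binary.Permutation.Propositional.Properties using
  (All-resp-↭; ↭-length; ++⁺ˡ; ++⁺ʳ; shift; ++-comm; ∈-resp-↭; ++↭ʳ++)
import Data.List.Relation.Binary.Permutation.Setoid.Properties as Permutationₛ
open import Data.List.Relation.Binary.Pointwise as Pointwise using (Pointwise; []; _∷_)
open import Data.List.Relation.Unary.All as All using (All; []; _∷_)
import Data.List.Relation.Unary.All.Properties as All
open import Data.List.Relation.Unary.AllPairs using ([]; _∷_)
open import Data.List.Relation.Unary.Any using (Any; here; there)
open import Data.List.Relation.Unary.Linked using (Linked; []; [-]; _∷_)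
import Data.List.Relation.Unary.Linked.Properties as Linked
open import Data.List.Relation.Unary.Unique.DecPropositional.Properties using (deduplicate-!)
open import Data.List.Relation.Unary.Unique.Propositional using (Unique)
import Data.List.Relation.Unary.Unique.Propositional.Properties as Unique
open import Data.Nat.Base using
  ( zero; suc; pred; _+_; _<_; z≤n; s≤s; s≤s⁻¹; ⌊_/2⌋; ⌈_/2⌉)
open import Data.Nat.DivMod using (m<n*o⇒m/o<n)
open import Data.Nat.Properties hiding (_≟_)
open import Data.Nat.Tactic.RingSolver using (solve-∀)
open import Data.Product using (∃₂; _,_; proj₁; proj₂; map₁; map₂)
open import Data.Rational using (0ℚ; toℚᵘ)
import Data.Rational as ℚ
import Data.Rational.Properties as ℚ
open import Data.Rational.Unnormalised as ℚᵘ using (mkℚᵘ; *≤*)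
import Data.Rational.Unnormalised.Properties as ℚᵘ
open import Data.Sum.Base as Sum using (_⊎_; inj₁; inj₂; [_,_]′)
open import Data.Unit using (⊤)
open import Data.Vec.Base as Vec using (Vec; []; _∷_; _∷ʳ_; lookup; fromList; toList)
open import Data.Vec.Properties using
  ( reverse-∷; toList-reverse; toList-injective; toList∘fromList; length-toList; cast-is-id
  ; lookup∘tabulate; lookup⇒[]=; tabulate-cong)
open import Data.Vec.Relation.Unary.All using ([]; _∷_)
import Data.Vec.Relation.Unary.All.Properties as Vec
open import Data.Vec.Relation.Unary.AllPairs using ([]; _∷_)
import Data.Vec.Relation.Unary.Unique.Propositional as Vec
open import Function.Base using (_∘_; id)
open import Function.Bundles using (mk⇔)
open import Relation.Binary using (Rel; Symmetric)
open import Relation.Binary.PropositionalEquality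
  using (_≡_; _≢_; refl; sym; trans; cong; cong₂; subst; subst₂; setoid; module ≡-Reasoning)
open import Relation.Nullary using (¬_; ¬?; Dec; yes; no; _×-dec_)
open import Relation.Nullary.Decidable using (dec-true; does-⇔)
open import Relation.Nullary.Negation using (contradiction)

open Colouring using (colour; colour-sym)

private variable
  A B : Set

-- Longest monochromatic paths

Unique-resp-↭ : {xs ys : List A} → xs ↭ ys → Unique xs → Unique ys
Unique-resp-↭ p = Permutationₛ.Unique-resp-↭ (setoid _) (↭⇒↭ₛ p)

unique-++ˡ : (xs : List A) {ys : List A} → Unique (xs ++ ys) → Unique xs
unique-++ˡ []       _         = []
unique-++ˡ (x ∷ xs) (x∉ ∷ uniq) = All.++⁻ˡ xs x∉ ∷ unique-++ˡ xs uniq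

∈-∃↭ : {x : A} {xs : List A} → x ∈ xs → ∃[ ys ] xs ↭ x ∷ ys
∈-∃↭ {x = x} x∈xs with as , bs , refl ← ∈-∃++ x∈xs = as ++ bs , shift x as bs

any⊎all : {P Q : A → Set} {xs : List A} → All (λ x → P x ⊎ Q x) xs → Any P xs ⊎ All Q xs
any⊎all []            = inj₂ []
any⊎all (inj₁ p ∷ _)  = inj₁ (here p)
any⊎all (inj₂ q ∷ as) = Sum.map there (q ∷_) (any⊎all as)

interleave : List A → List A → List A
interleave []       ys = ys
interleave (x ∷ xs) ys = x ∷ interleave ys xs

interleave-↭ : (xs ys : List A) → interleave xs ys ↭ ys ++ xs
interleave-↭ []       ys = ↭-reflexive (sym (++-identityʳ ys))
interleave-↭ (x ∷ xs) ys = begin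
  x ∷ interleave ys xs ↭⟨ prep x (interleave-↭ ys xs) ⟩
  x ∷ xs ++ ys         ↭⟨ ++-comm (x ∷ xs) ys ⟩
  ys ++ x ∷ xs         ∎
  where open PermutationReasoning

module BluePath {S : Rel A 0ℓ} (S-sym : Symmetric S) where

  -- Holds for every vertex u that cannot be inserted into a red path after
  -- its first vertex.
  Meets : A → List A → Set
  Meets u []           = ⊤
  Meets u (x ∷ [])     = S u x
  Meets u (a ∷ b ∷ zs) = (S u a ⊎ S u b) × Meets u (b ∷ zs)

  -- The number of disjoint pairs that `weave` can use up. The last entry never belongs to a pair,
  -- because the finished blue path begins there; on a nonempty list the value is the floor of
  -- (length - 1)/2.
  pairs : List A → ℕ
  pairs (_ ∷ _ ∷ z ∷ zs) = suc (pairs (z ∷ zs))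
  pairs _                = 0

  -- Every edge of the alternating list joins an element of `cs`, or `x`, to an element of `ws`. The
  -- one extra element in `ws` lets the list both start and end there.
  interleave-linked : ∀ {x} ws cs → length ws ≡ suc (length cs) →
                      All (S x) ws → All (λ c → All (S c) ws) cs →
                      Linked S (x ∷ interleave ws cs)
  interleave-linked (w ∷ []) [] _ (xw ∷ _) _ = xw ∷ [-]
  interleave-linked (w ∷ v ∷ ws) (c ∷ cs) eq (xw ∷ _) ((cw ∷ cws) ∷ all) =
    xw ∷ S-sym cw ∷ interleave-linked (v ∷ ws) cs (suc-injective eq) cws (All.map All.tail all)

  module _ (x₁ : A) where

    -- y ∷ Q ++ [ x₁ ] is a blue path, W are the outer vertices still unused
    -- and C are path vertices that see all of W in blue.  Of the next two
    -- path vertices a, b, one either extends the blue path to an element of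
    -- W or joins C.
    weave : ∀ z zs y Q W C →
            Unique (z ∷ zs ++ C ++ W ++ y ∷ Q ++ [ x₁ ]) →
            All (λ u → Meets u (z ∷ zs)) (y ∷ W) →
            All (λ c → All (S c) W) C →
            All (S x₁) W →
            (∀ Z → Linked S (x₁ ∷ Z) → Linked S (y ∷ Q ++ x₁ ∷ Z)) →
            length W ≡ suc (length C + pairs (z ∷ zs)) →
            ∃[ F ] Unique F × Linked S F ×
              length F ≡ 4 + length Q + 2 * length C + 2 * pairs (z ∷ zs)

    -- By symmetry of the pair, `a` is the vertex that `y` sees. Both outcomes use up one pair, keep
    -- the balance `length W ≡ suc (length C + pairs …)` and add two to the final length, so that
    -- length does not depend on the choices made. Linkedness of the blue path is carried as a
    -- function of its continuation beyond `x₁`.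
    step : ∀ a b z zs y Q W C → S y a →
           Unique (a ∷ b ∷ z ∷ zs ++ C ++ W ++ y ∷ Q ++ [ x₁ ]) →
           Meets y (z ∷ zs) →
           All (λ w → S w a ⊎ S w b) W →
           All (λ w → Meets w (z ∷ zs)) W →
           All (λ c → All (S c) W) C →
           All (S x₁) W →
           (∀ Z → Linked S (x₁ ∷ Z) → Linked S (y ∷ Q ++ x₁ ∷ Z)) →
           length W ≡ suc (length C + suc (pairs (z ∷ zs))) →
           ∃[ F ] Unique F × Linked S F ×
             length F ≡ 4 + length Q + 2 * length C + 2 * suc (pairs (z ∷ zs))

    -- No pair is left and `z` is the far end of the red path. The blue path runs `z`, `y`, `Q`,
    -- `x₁` and then alternates between `W` and `C`, which by now differ in size by one.
    weave z [] y Q W C uniq (yz ∷ _) cw xw path len =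
      z ∷ y ∷ Q ++ x₁ ∷ interleave W C ,
      Unique-resp-↭ perm uniq ,
      S-sym yz ∷ path _ (interleave-linked W C len′ xw cw) ,
      trans (cong (λ z → 2 + z) (trans (length-++ Q)
        (cong (λ k → length Q + suc k) (trans (↭-length (interleave-↭ W C)) (length-++ C)))))
        (trans (cong (λ k → 2 + (length Q + suc (length C + k))) len′)
          (arith (length Q) (length C)))
      where
      len′ : length W ≡ suc (length C)
      len′ = trans len (cong suc (+-identityʳ _))

      arith : ∀ q c → 2 + (q + suc (c + suc c)) ≡ 4 + q + 2 * c + 0
      arith = solve-∀

      open PermutationReasoning
      perm : z ∷ C ++ W ++ y ∷ Q ++ [ x₁ ] ↭ z ∷ y ∷ Q ++ x₁ ∷ interleave W C
      perm = prep z (begin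
        C ++ W ++ y ∷ Q ++ [ x₁ ]             ≡⟨ ++-assoc C W _ ⟨
        (C ++ W) ++ y ∷ Q ++ [ x₁ ]           ↭⟨ ++⁺ʳ _ (interleave-↭ W C) ⟨
        interleave W C ++ y ∷ Q ++ [ x₁ ]     ↭⟨ ++-comm (interleave W C) _ ⟩
        (y ∷ Q ++ [ x₁ ]) ++ interleave W C   ≡⟨ cong (y ∷_) (++-assoc Q _ _) ⟩
        y ∷ Q ++ x₁ ∷ interleave W C          ∎)
    -- Of two remaining vertices only the last is certainly seen by every outer vertex, so the other
    -- one is dropped.
    weave l (z ∷ []) y Q W C (_ ∷ uniq) ms cw xw path len =
      weave z [] y Q W C uniq (All.map proj₂ ms) cw xw path len
    weave a (b ∷ z ∷ zs) y Q W C uniq ((inj₁ ya , my) ∷ ms) =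
      step a b z zs y Q W C ya uniq (proj₂ my) (All.map proj₁ ms) (All.map (proj₂ ∘ proj₂) ms)
    weave a (b ∷ z ∷ zs) y Q W C uniq ((inj₂ yb , my) ∷ ms) =
      step b a z zs y Q W C yb (Unique-resp-↭ (swap a b ↭-refl) uniq)
        (proj₂ my) (All.map (Sum.swap ∘ proj₁) ms) (All.map (proj₂ ∘ proj₂) ms)

    step a b z zs y Q W C ya uniq@(a∉ ∷ b∉ ∷ uniq′) my ab ms cw xw path len with any⊎all ab
    -- All of `W` sees `b`, so `b` joins `C` and `a` is given up.
    ... | inj₂ bw =
      let F , u , l , e = weave z zs y Q W (b ∷ C)
            (Unique-resp-↭ (↭-sym (shift b (z ∷ zs) _)) (b∉ ∷ uniq′)) (my ∷ ms)
            (All.map S-sym bw ∷ cw) xw path (trans len (cong suc (+-suc _ _)))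
      in F , u , l , trans e (arith (length Q) (length C) (pairs (z ∷ zs)))
      where
      arith : ∀ q c p → 4 + q + 2 * suc c + 2 * p ≡ 4 + q + 2 * c + 2 * suc p
      arith = solve-∀
    -- Some `w` sees `a`, so the blue path grows at its front to `w`, `a`, `y`, ... and `b` is given
    -- up.
    ... | inj₁ aw with w , w∈W , wa ← find aw with W′ , W↭ ← ∈-∃↭ w∈W =
      let F , u , l , e = weave z zs w (a ∷ y ∷ Q) W′ C
            (Unique-resp-↭ perm (All.tail a∉ ∷ uniq′))
            (All-resp-↭ W↭ ms) (All.map (All.tail ∘ All-resp-↭ W↭) cw) (All.tail (All-resp-↭ W↭ xw))
            (λ Z xZ → wa ∷ S-sym ya ∷ path Z xZ)
            (suc-injective (trans (sym (↭-length W↭)) (trans len (cong suc (+-suc _ _)))))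
      in F , u , l , trans e (arith (length Q) (length C) (pairs (z ∷ zs)))
      where
      arith : ∀ q c p → 4 + (2 + q) + 2 * c + 2 * p ≡ 4 + q + 2 * c + 2 * suc p
      arith = solve-∀

      T = y ∷ Q ++ [ x₁ ]

      open PermutationReasoning
      perm : a ∷ z ∷ zs ++ C ++ W ++ T ↭ z ∷ zs ++ C ++ W′ ++ w ∷ a ∷ T
      perm = begin
        a ∷ z ∷ zs ++ C ++ W ++ T        ↭⟨ shift a (z ∷ zs) _ ⟨
        z ∷ zs ++ a ∷ C ++ W ++ T        ↭⟨ ++⁺ˡ (z ∷ zs) (shift a C _) ⟨
        z ∷ zs ++ C ++ a ∷ W ++ T        ↭⟨ ++⁺ˡ (z ∷ zs) (++⁺ˡ C (prep a (++⁺ʳ T W↭))) ⟩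
        z ∷ zs ++ C ++ a ∷ w ∷ W′ ++ T   ↭⟨ ++⁺ˡ (z ∷ zs) (++⁺ˡ C (swap a w ↭-refl)) ⟩
        z ∷ zs ++ C ++ w ∷ a ∷ W′ ++ T   ↭⟨ ++⁺ˡ (z ∷ zs) (++⁺ˡ C (prep w (shift a W′ T))) ⟨
        z ∷ zs ++ C ++ w ∷ W′ ++ a ∷ T   ↭⟨ ++⁺ˡ (z ∷ zs) (++⁺ˡ C (shift w W′ _)) ⟨
        z ∷ zs ++ C ++ W′ ++ w ∷ a ∷ T   ∎

  -- This bound limits how many outer vertices `lengthen` asks for; its companion `pairs-upper`
  -- makes the blue path longer than the red one.
  pairs-lower : ∀ z zs → suc (2 * pairs (z ∷ zs)) ≤ length (z ∷ zs)
  pairs-lower z []             = s≤s z≤n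
  pairs-lower z (_ ∷ [])       = s≤s z≤n
  pairs-lower _ (_ ∷ z ∷ zs) =
    subst (_≤ 2 + length (z ∷ zs)) (cong suc (sym (*-suc 2 (pairs (z ∷ zs))))) (s≤s (s≤s (pairs-lower z zs)))

  pairs-upper : ∀ z zs → length (z ∷ zs) ≤ 2 + 2 * pairs (z ∷ zs)
  pairs-upper z []             = s≤s z≤n
  pairs-upper z (_ ∷ [])       = s≤s (s≤s z≤n)
  pairs-upper _ (_ ∷ z ∷ zs) =
    subst (2 + length (z ∷ zs) ≤_) (cong (λ z → 2 + z) (sym (*-suc 2 (pairs (z ∷ zs))))) (s≤s (s≤s (pairs-upper z zs)))

  module _ {R : Rel A 0ℓ} (R-sym : Symmetric R) (R⊎S : ∀ u x → R u x ⊎ S u x) where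

    Insertable : A → List A → Set
    Insertable u xs = ∃[ ys ] Linked R ys × ys ↭ u ∷ xs

    -- If `u` is joined in `R` to two consecutive vertices, it fits between them; otherwise each
    -- consecutive pair supplies an `S`-edge. Keeping the head fixed allows a recursive result to be
    -- prefixed with the edge before it.
    insert-after-head : ∀ u x zs → Linked R (x ∷ zs) →
      (∃[ ys ] Linked R (x ∷ ys) × x ∷ ys ↭ u ∷ x ∷ zs) ⊎ Meets u (x ∷ zs)
    insert-after-head u x [] _ with R⊎S u x
    ... | inj₁ r = inj₁ (u ∷ [] , R-sym r ∷ [-] , swap x u ↭-refl)
    ... | inj₂ s = inj₂ s
    insert-after-head u x (b ∷ zs) (xb ∷ link) with insert-after-head u b zs link
    ... | inj₁ (ys , l , p) = inj₁ (b ∷ ys , xb ∷ l , ↭-trans (prep x p) (swap x u ↭-refl))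
    ... | inj₂ m with R⊎S u x | R⊎S u b
    ...   | inj₂ s | _      = inj₂ (inj₁ s , m)
    ...   | inj₁ _ | inj₂ s = inj₂ (inj₂ s , m)
    ...   | inj₁ r | inj₁ q = inj₁ (u ∷ b ∷ zs , R-sym r ∷ q ∷ link , swap x u ↭-refl)

    insertable? : ∀ u x zs → Linked R (x ∷ zs) →
                  Insertable u (x ∷ zs) ⊎ (S u x × Meets u (x ∷ zs))
    insertable? u x zs link with R⊎S u x | insert-after-head u x zs link
    ... | inj₁ r | _                = inj₁ (u ∷ x ∷ zs , r ∷ link , ↭-refl)
    ... | inj₂ _ | inj₁ (ys , l , p) = inj₁ (x ∷ ys , l , p)
    ... | inj₂ s | inj₂ m           = inj₂ (s , m)

    -- If no outer vertex can be inserted, one of them becomes the first `y` of `weave` and the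
    -- other `1 + pairs (z ∷ zs)` become `W`, with `Q` and `C` empty. The resulting blue path has
    -- `4 + 2 * pairs (z ∷ zs)` vertices, at least one more than the red path.
    lengthen : ∀ x z zs U → Linked R (x ∷ z ∷ zs) → Unique (x ∷ z ∷ zs ++ U) →
               length U ≡ 2 + pairs (z ∷ zs) →
               (∃[ F ] Unique F × Linked R F × 3 + length zs ≤ length F) ⊎
               (∃[ F ] Unique F × Linked S F × 3 + length zs ≤ length F)
    lengthen x z zs U link uniq len
      with any⊎all {xs = U} (All.tabulate λ {u} _ → insertable? u x (z ∷ zs) link)
    ... | inj₁ ins with u , u∈U , ys , l , p ← find ins with U′ , U↭ ← ∈-∃↭ u∈U =
      inj₁ (ys , Unique-resp-↭ (↭-sym p) (unique-++ˡ (u ∷ x ∷ z ∷ zs) (Unique-resp-↭ perm uniq))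
               , l , ≤-reflexive (sym (↭-length p)))
      where
      perm : x ∷ z ∷ zs ++ U ↭ (u ∷ x ∷ z ∷ zs) ++ U′
      perm = ↭-trans (++⁺ˡ (x ∷ z ∷ zs) U↭) (shift u (x ∷ z ∷ zs) U′)
    lengthen x z zs (y ∷ W) link uniq len | inj₂ ((yx , my) ∷ sm) =
      let F , u , l , e = weave x z zs y [] W []
            (Unique-resp-↭ perm uniq)
            (proj₂ my ∷ All.map (proj₂ ∘ proj₂) sm) [] (All.map (S-sym ∘ proj₁) sm)
            (λ _ l → yx ∷ l) (suc-injective len)
      in inj₂ (F , u , l , subst (_ ≤_) (sym e) (s≤s (s≤s (pairs-upper z zs))))
      where
      open PermutationReasoning
      perm : x ∷ z ∷ zs ++ y ∷ W ↭ z ∷ zs ++ W ++ y ∷ [ x ]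
      perm = begin
        x ∷ z ∷ zs ++ y ∷ W           ↭⟨ ++-comm [ x ] (z ∷ zs ++ y ∷ W) ⟩
        (z ∷ zs ++ y ∷ W) ++ [ x ]    ≡⟨ ++-assoc (z ∷ zs) (y ∷ W) [ x ] ⟩
        z ∷ zs ++ y ∷ W ++ [ x ]      ↭⟨ ++⁺ˡ (z ∷ zs) (shift y W [ x ]) ⟨
        z ∷ zs ++ W ++ y ∷ [ x ]      ∎

-- Each element of `xs` uses up its partner, and injectivity keeps the partners of the others among
-- what remains. A relation is used instead of a map because a copy of a path has a code for each of
-- its two directions, and either may be the listed one.
length-≤-via : {R : A → B → Set} → (∀ {x y b} → R x b → R y b → x ≡ y) →
               ∀ {xs} {ys : List B} → Unique xs → All (λ x → ∃[ b ] b ∈ ys × R x b) xs → length xs ≤ length ys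
length-≤-via inj []            _ = z≤n
length-≤-via {R = R} inj {x ∷ xs} {ys} (x∉ ∷ uniq) ((b , b∈ , r) ∷ rs) with zs , ys↭ ← ∈-∃↭ b∈ =
  subst (suc (length xs) ≤_) (sym (↭-length ys↭))
    (s≤s (length-≤-via inj uniq (All.zipWith avoid (x∉ , rs))))
  where
  avoid : ∀ {y} → x ≢ y × (∃[ c ] c ∈ ys × R y c) → ∃[ c ] c ∈ zs × R y c
  avoid (x≢y , c , c∈ , q) with ∈-resp-↭ ys↭ c∈
  ... | here refl = contradiction (inj r q) x≢y
  ... | there c∈zs = c , c∈zs , q

unique-⊆-length : {xs ys : List A} → Unique xs → (∀ {x} → x ∈ xs → x ∈ ys) →
                  length xs ≤ length ys
unique-⊆-length uniq xs⊆ys = length-≤-via {R = _≡_} (λ { refl refl → refl }) uniq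
  (All.tabulate λ {x} x∈ → x , xs⊆ys x∈ , refl)

-- The Ramsey number bound

other : Colour → Colour
other red  = blue
other blue = red

≡⊎≡other : ∀ x y → y ≡ x ⊎ y ≡ other x
≡⊎≡other red  red  = inj₁ refl
≡⊎≡other red  blue = inj₂ refl
≡⊎≡other blue red  = inj₂ refl
≡⊎≡other blue blue = inj₁ refl

module _ {n : ℕ} (c : Colouring n) where

  open import Data.List.Membership.DecPropositional (_≟_ {n}) using (_∈?_)

  Mono : Colour → Fin n → Fin n → Set
  Mono x i j = colour c i j ≡ x

  mono-sym : ∀ x → Symmetric (Mono x)
  mono-sym x {i} {j} e = trans (colour-sym c j i) e

  MonoPath : ℕ → Set
  MonoPath k = ∃₂ λ x xs → Unique xs × Linked (Mono x) xs × k ≤ length xs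

  outside : List (Fin n) → List (Fin n)
  outside xs = filter (λ i → ¬? (i ∈? xs)) (allFin n)

  outside-length : ∀ xs → n ≤ length xs + length (outside xs)
  outside-length xs = subst₂ _≤_ (length-tabulate id) (length-++ xs)
    (unique-⊆-length (Unique.allFin⁺ n) λ {i} _ → cover i)
    where
    cover : ∀ i → i ∈ xs ++ outside xs
    cover i with i ∈? xs
    ... | yes i∈ = ∈-++⁺ˡ i∈
    ... | no  i∉ = ∈-++⁺ʳ xs (∈-filter⁺ (λ i → ¬? (i ∈? xs)) (∈-allFin i) i∉)

  module _ {t : ℕ} (n-large : 3 * t ≤ suc n) where

    -- Twice `3t - 1 ≤ k + o` against three times `k + 1 ≤ 2t` eliminates `t` and leaves `k < 2o`.
    -- With `2 + 2p ≤ k` this gives `p + 1 < o`.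
    enough-outside : ∀ k o p → n ≤ k + o → k < 2 * t → suc (suc (2 * p)) ≤ k → 2 + p ≤ o
    enough-outside k o p n≤ k<2t 2p<k = *-cancelˡ-< 2 (suc p) o (begin-strict
      2 * suc p     ≡⟨ *-suc 2 p ⟩
      2 + 2 * p     ≤⟨ 2p<k ⟩
      k             <⟨ +-cancelˡ-≤ (2 + 2 * k) _ _ (begin
        2 + 2 * k + suc k  ≡⟨ e₁ k ⟩
        3 * suc k          ≤⟨ *-monoʳ-≤ 3 k<2t ⟩
        3 * (2 * t)        ≡⟨ e₂ t ⟩
        2 * (3 * t)        ≤⟨ *-monoʳ-≤ 2 (≤-trans n-large (s≤s n≤)) ⟩
        2 * suc (k + o)    ≡⟨ e₃ k o ⟩
        2 + 2 * k + 2 * o  ∎) ⟩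
      2 * o         ∎)
      where
      open ≤-Reasoning
      e₁ : ∀ k → 2 + 2 * k + suc k ≡ 3 * suc k
      e₁ = solve-∀
      e₂ : ∀ t → 3 * (2 * t) ≡ 2 * (3 * t)
      e₂ = solve-∀
      e₃ : ∀ k o → 2 * suc (k + o) ≡ 2 + 2 * k + 2 * o
      e₃ = solve-∀

    grow : ∀ x a b zs → Unique (a ∷ b ∷ zs) → Linked (Mono x) (a ∷ b ∷ zs) →
           2 + length zs < 2 * t → MonoPath (3 + length zs)
    grow x a b zs uniq link short =
      [ (x ,_) , (other x ,_) ]′
        (lengthen (λ {i} → mono-sym x {i}) (λ i j → ≡⊎≡other x (colour c i j))
          a b zs U link
          (Unique.++⁺ uniq (Unique.take⁺ (2 + p) (Unique.filter⁺ _ (Unique.allFin⁺ n))) disjoint)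
          (trans (length-take (2 + p) (outside xs)) (m≤n⇒m⊓n≡m enough)))
      where
      open BluePath {S = Mono (other x)} (λ {i} → mono-sym (other x) {i})

      xs = a ∷ b ∷ zs
      p  = pairs (b ∷ zs)
      U  = take (2 + p) (outside xs)

      enough : 2 + p ≤ length (outside xs)
      enough = enough-outside (length xs) (length (outside xs)) p (outside-length xs) short
                 (s≤s (pairs-lower b zs))

      disjoint : ∀ {i} → ¬ (i ∈ xs × i ∈ U)
      disjoint (i∈xs , i∈U) = All.lookup
        (All.take⁺ (2 + p) (All.all-filter (λ i → ¬? (i ∈? xs)) (allFin n))) i∈U i∈xs

    monoPath : ∀ k → 2 ≤ n → k ≤ 2 * t → MonoPath k
    monoPath zero          _   _   = red , [] , [] , [] , z≤n
    monoPath (suc k) 2≤n k<2t with monoPath k 2≤n (<⇒≤ k<2t)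
    ... | x , xs , uniq , link , k≤ with k <? length xs
    ...   | yes k< = x , xs , uniq , link , k<
    ...   | no  k≮ = go xs uniq link (≤-antisym k≤ (≮⇒≥ k≮))
      where
      i₀ i₁ : Fin n
      i₀ = fromℕ< {0} (≤-trans (s≤s z≤n) 2≤n)
      i₁ = fromℕ< {1} 2≤n

      i₀≢i₁ : i₀ ≢ i₁
      i₀≢i₁ e with () ← trans (sym (toℕ-fromℕ< (≤-trans (s≤s z≤n) 2≤n)))
                          (trans (cong toℕ e) (toℕ-fromℕ< 2≤n))

      -- `lengthen` starts from two vertices, so lengths 0 and 1 are treated by hand; a single edge
      -- is a path in its own colour.
      go : ∀ xs → Unique xs → Linked (Mono x) xs → k ≡ length xs → MonoPath (suc k)
      go []           _    _    refl = red , i₀ ∷ [] , [] ∷ [] , [-] , s≤s z≤n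
      go (_ ∷ [])     _    _    refl = colour c i₀ i₁ , i₀ ∷ i₁ ∷ [] ,
        (i₀≢i₁ ∷ []) ∷ [] ∷ [] , refl ∷ [-] , s≤s (s≤s z≤n)
      go (a ∷ b ∷ zs) uniq link refl = grow x a b zs uniq link k<2t

unique-fromList : {xs : List A} → Unique xs → Vec.Unique (fromList xs)
unique-fromList []          = []
unique-fromList (x∉ ∷ uniq) = Vec.fromList⁺ x∉ ∷ unique-fromList uniq

module _ {R : Rel A 0ℓ} where

  linked-take : ∀ k {xs} → Linked R xs → Linked R (take k xs)
  linked-take zero          _       = []
  linked-take (suc k)       []      = []
  linked-take (suc k)       [-]     = subst (λ l → Linked R (_ ∷ l)) (sym (take-[] k)) [-]
  linked-take (suc zero)    (_ ∷ _) = [-]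
  linked-take (suc (suc k)) (r ∷ l) = r ∷ linked-take (suc k) l

  linked⇒lookup : ∀ {k} (f : Vec A k) → Linked R (toList f) →
                  ∀ u v → suc (toℕ u) ≡ toℕ v → R (lookup f u) (lookup f v)
  linked⇒lookup (_ ∷ _ ∷ _) (r ∷ _) zero    (suc zero) _ = r
  linked⇒lookup (_ ∷ _ ∷ f) (_ ∷ l) (suc u) (suc v)    e =
    linked⇒lookup (_ ∷ f) l u v (suc-injective e)

  lookup⇒linked : ∀ {k} (f : Vec A k) →
                  (∀ u v → suc (toℕ u) ≡ toℕ v → R (lookup f u) (lookup f v)) →
                  Linked R (toList f)
  lookup⇒linked []          _ = []
  lookup⇒linked (_ ∷ [])    _ = [-]
  lookup⇒linked (_ ∷ _ ∷ f) r =
    r zero (suc zero) refl ∷ lookup⇒linked (_ ∷ f) (λ u v e → r (suc u) (suc v) (cong suc e))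

list⇒hasMonoCopy : ∀ {n} (c : Colouring n) {x k} (xs : List (Fin n)) → Unique xs →
                   Linked (Mono c x) xs → length xs ≡ k → HasMonoCopy (path k) c
list⇒hasMonoCopy {n} c {x} xs uniq link refl =
  image (path (length xs)) f ,
  ∈-deduplicate⁺ _≟ˢ_ (∈-map⁺ (image (path (length xs)))
    (∈-filter⁺ unique? (∈-vectors ∈-allFin f) (unique-fromList uniq))) ,
  x , mono
  where
  f = fromList xs

  linkf : Linked (Mono c x) (toList f)
  linkf = subst (Linked _) (sym (toList∘fromList xs)) link

  mono : Monochromatic c x (image (path (length xs)) f)
  mono i j j∈ with image-edge (path (length xs)) f i j j∈
  ... | u , v , inj₁ e , refl , refl = linked⇒lookup f linkf u v e
  ... | u , v , inj₂ e , refl , refl = mono-sym c x (linked⇒lookup f linkf v u e)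

arrows-path : ∀ t {n} → 2 ≤ n → 3 * t ≤ suc n → Arrows (path (2 * t)) n
arrows-path t {n} 2≤n n-large c with x , xs , uniq , link , 2t≤ ← monoPath c {t} n-large (2 * t) 2≤n ≤-refl =
  list⇒hasMonoCopy c (take (2 * t) xs) (Unique.take⁺ (2 * t) uniq) (linked-take (2 * t) link)
    (trans (length-take (2 * t) xs) (m≤n⇒m⊓n≡m 2t≤))

r-path-upper : ∀ t {n} → 2 ≤ n → 3 * t ≤ suc n → r (path (2 * t)) ≤ n
r-path-upper t {n} 2≤n n-large =
  proj₂ (proj₂ (ramseyNumber (path (2 * t)))) n (<⇒≤ 2≤n , arrows-path t 2≤n n-large)

-- Words and their fillings

falling : ℕ → ℕ → ℕ
falling n zero    = 1
falling n (suc k) = n * falling (pred n) k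

falling-! : ∀ k l → falling (k + l) k * l ! ≡ (k + l) !
falling-! zero    l = +-identityʳ (l !)
falling-! (suc k) l = trans (*-assoc (suc (k + l)) (falling (k + l) k) (l !))
                        (cong (suc (k + l) *_) (falling-! k l))

falling-self : ∀ n → falling n n ≡ n !
falling-self zero    = refl
falling-self (suc n) = cong (suc n *_) (falling-self n)

falling-zero : ∀ {n k} → n < k → falling n k ≡ 0
falling-zero {zero}  (s≤s _)   = refl
falling-zero {suc n} (s≤s n<k) = trans (cong (suc n *_) (falling-zero n<k)) (*-zeroʳ (suc n))

length-concatMap : (f : A → List B) {xs : List A} {k : ℕ} →
                   All (λ x → length (f x) ≡ k) xs → length (concatMap f xs) ≡ length xs * k
length-concatMap f []               = refl
length-concatMap f {x ∷ xs} (e ∷ es) =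
  trans (length-++ (f x)) (cong₂ _+_ e (length-concatMap f es))

∈-concatMap : (f : A → List B) {xs : List A} {x : A} {y : B} →
              x ∈ xs → y ∈ f x → y ∈ concatMap f xs
∈-concatMap f x∈ y∈ = ∈-concatMap⁺ f (lose x∈ y∈)

picks : List A → List (A × List A)
picks []       = []
picks (x ∷ xs) = (x , xs) ∷ map (map₂ (x ∷_)) (picks xs)

length-picks : (xs : List A) → length (picks xs) ≡ length xs
length-picks []       = refl
length-picks (x ∷ xs) = cong suc (trans (length-map _ (picks xs)) (length-picks xs))

length-picked : (xs : List A) → All (λ (_ , ys) → suc (length ys) ≡ length xs) (picks xs)
length-picked []       = []
length-picked (x ∷ xs) = refl ∷ All.map⁺ (All.map (cong suc) (length-picked xs))

∈-picks : {x : A} {xs : List A} → x ∈ xs → ∃[ ys ] (x , ys) ∈ picks xs × xs ↭ x ∷ ys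
∈-picks (here refl) = _ , here refl , ↭-refl
∈-picks {xs = x ∷ _} (there x∈) with ys , y∈ , p ← ∈-picks x∈ =
  x ∷ ys , there (∈-map⁺ _ y∈) , ↭-trans (prep x p) (swap x _ ↭-refl)

length-concatMap-picks : (f : A × List A → List B) (xs : List A) {n k : ℕ} → length xs ≡ n →
  (∀ x ys → suc (length ys) ≡ n → length (f (x , ys)) ≡ k) →
  length (concatMap f (picks xs)) ≡ n * k
length-concatMap-picks f xs {k = k} refl len = trans
  (length-concatMap f (All.map (λ {(x , ys)} → len x ys) (length-picked xs)))
  (cong (_* k) (length-picks xs))

length-concatMap-upTo : (f : ℕ → List B) (n : ℕ) {k : ℕ} →
  (∀ {i} → i < n → length (f i) ≡ k) → length (concatMap f (upTo n)) ≡ n * k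
length-concatMap-upTo f n {k} len = trans
  (length-concatMap f (All.tabulate (len ∘ ∈-upTo⁻)))
  (cong (_* k) (length-upTo n))

-- α and β stand for entries drawn, without repetition, from the first and
-- the second of two pools.
data Symbol (A : Set) : Set where
  α β : Symbol A
  the : A → Symbol A

#α #β : List (Symbol A) → ℕ
#α []          = 0
#α (α     ∷ w) = suc (#α w)
#α (β     ∷ w) = #α w
#α (the _ ∷ w) = #α w
#β []          = 0
#β (α     ∷ w) = #β w
#β (β     ∷ w) = suc (#β w)
#β (the _ ∷ w) = #β w

#α-ʳ++ : (w w′ : List (Symbol A)) → #α (w ʳ++ w′) ≡ #α w + #α w′
#α-ʳ++ []          w′ = refl
#α-ʳ++ (α     ∷ w) w′ = trans (#α-ʳ++ w (α ∷ w′)) (+-suc (#α w) (#α w′))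
#α-ʳ++ (β     ∷ w) w′ = #α-ʳ++ w (β ∷ w′)
#α-ʳ++ (the a ∷ w) w′ = #α-ʳ++ w (the a ∷ w′)

#β-ʳ++ : (w w′ : List (Symbol A)) → #β (w ʳ++ w′) ≡ #β w + #β w′
#β-ʳ++ []          w′ = refl
#β-ʳ++ (α     ∷ w) w′ = #β-ʳ++ w (α ∷ w′)
#β-ʳ++ (β     ∷ w) w′ = trans (#β-ʳ++ w (β ∷ w′)) (+-suc (#β w) (#β w′))
#β-ʳ++ (the a ∷ w) w′ = #β-ʳ++ w (the a ∷ w′)

fill : List (Symbol A) → List A → List A → List (List A)
fill []          X Y = [ [] ]
fill (α     ∷ w) X Y = concatMap (λ (x , X′) → map (x ∷_) (fill w X′ Y)) (picks X)
fill (β     ∷ w) X Y = concatMap (λ (y , Y′) → map (y ∷_) (fill w X Y′)) (picks Y)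
fill (the a ∷ w) X Y = map (a ∷_) (fill w X Y)

-- Each symbol `α` or `β` multiplies the count by the current size of its pool and shrinks that pool
-- by one; a named entry leaves the count alone.
length-fill : (w : List (Symbol A)) (X Y : List A) →
              length (fill w X Y) ≡ falling (length X) (#α w) * falling (length Y) (#β w)
length-fill []      X Y = refl
length-fill (α ∷ w) X Y = trans
  (length-concatMap-picks _ X refl λ x X′ e → trans (length-map _ (fill w X′ Y)) (trans (length-fill w X′ Y)
    (cong (λ l → falling l (#α w) * falling (length Y) (#β w)) (cong pred e))))
  (sym (*-assoc (length X) _ _))
length-fill (β ∷ w) X Y = trans
  (length-concatMap-picks _ Y refl λ y Y′ e → trans (length-map _ (fill w X Y′)) (trans (length-fill w X Y′)
    (cong (λ l → falling (length X) (#α w) * falling l (#β w)) (cong pred e))))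
  (x∙yz≈y∙xz (length Y) (falling (length X) (#α w)) _)
  where
  x∙yz≈y∙xz : ∀ a b c → a * (b * c) ≡ b * (a * c)
  x∙yz≈y∙xz = solve-∀
length-fill (the a ∷ w) X Y = trans (length-map _ (fill w X Y)) (length-fill w X Y)

Suits : List A → List A → Symbol A → A → Set
Suits X Y α       z = z ∈ X
Suits X Y β       z = z ∈ Y
Suits X Y (the a) z = a ≡ z

-- Membership refers to the full pools, so repetitions are allowed here; `∈-fill` asks for
-- distinctness separately.
Fits : List (Symbol A) → List A → List A → List A → Set
Fits w X Y zs = Pointwise (Suits X Y) w zs

∈-shrink : {x z : A} {xs ys : List A} → xs ↭ x ∷ ys → x ≢ z → z ∈ xs → z ∈ ys
∈-shrink p x≢z z∈ with ∈-resp-↭ p z∈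
... | here z≡x = contradiction (sym z≡x) x≢z
... | there z∈ = z∈

fits-shrinkα : ∀ {w} {X X′ Y zs : List A} {x} → X ↭ x ∷ X′ → All (x ≢_) zs →
               Fits w X Y zs → Fits w X′ Y zs
fits-shrinkα p []        []       = []
fits-shrinkα {w = α ∷ _}     p (n ∷ ns) (s ∷ ss) = ∈-shrink p n s ∷ fits-shrinkα p ns ss
fits-shrinkα {w = β ∷ _}     p (n ∷ ns) (s ∷ ss) = s ∷ fits-shrinkα p ns ss
fits-shrinkα {w = the _ ∷ _} p (n ∷ ns) (s ∷ ss) = s ∷ fits-shrinkα p ns ss

fits-shrinkβ : ∀ {w} {X Y Y′ zs : List A} {y} → Y ↭ y ∷ Y′ → All (y ≢_) zs →
               Fits w X Y zs → Fits w X Y′ zs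
fits-shrinkβ p []        []       = []
fits-shrinkβ {w = α ∷ _}     p (n ∷ ns) (s ∷ ss) = s ∷ fits-shrinkβ p ns ss
fits-shrinkβ {w = β ∷ _}     p (n ∷ ns) (s ∷ ss) = ∈-shrink p n s ∷ fits-shrinkβ p ns ss
fits-shrinkβ {w = the _ ∷ _} p (n ∷ ns) (s ∷ ss) = s ∷ fits-shrinkβ p ns ss

-- An entry once drawn does not recur in the tail, so the tail still fits the shrunken pool.
∈-fill : ∀ w {X Y zs : List A} → Unique zs → Fits w X Y zs → zs ∈ fill w X Y
∈-fill []          _            []          = here refl
∈-fill (α     ∷ w) (z∉ ∷ uniq) (z∈ ∷ fits) with X′ , p∈ , p ← ∈-picks z∈ =
  ∈-concatMap _ p∈ (∈-map⁺ _ (∈-fill w uniq (fits-shrinkα p z∉ fits)))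
∈-fill (β     ∷ w) (z∉ ∷ uniq) (z∈ ∷ fits) with Y′ , p∈ , p ← ∈-picks z∈ =
  ∈-concatMap _ p∈ (∈-map⁺ _ (∈-fill w uniq (fits-shrinkβ p z∉ fits)))
∈-fill (the a ∷ w) (z∉ ∷ uniq) (refl ∷ fits) = ∈-map⁺ _ (∈-fill w uniq fits)

-- With more symbols `β` than elements of `Y`, the falling factorial contains a factor 0 and `fill`
-- is empty, yet `zs` lies in it.
#β-bound : ∀ w {X Y zs : List A} → Unique zs → Fits w X Y zs → #β w ≤ length Y
#β-bound w {X} {Y} uniq fits = ≮⇒≥ λ Y<β → nonempty (∈-fill w uniq fits)
  (trans (length-fill w X Y) (trans (cong (falling (length X) (#α w) *_) (falling-zero Y<β))
    (*-zeroʳ (falling (length X) (#α w)))))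
  where
  nonempty : {x : A} {xs : List A} → x ∈ xs → length xs ≢ 0
  nonempty (here _)  ()
  nonempty (there _) ()

fits-replicate : ∀ {X Y zs : List A} → All (_∈ X) zs → Fits (replicate (length zs) α) X Y zs
fits-replicate []        = []
fits-replicate (z∈ ∷ zs) = z∈ ∷ fits-replicate zs

#α-replicate : ∀ n → #α {A} (replicate n α) ≡ n
#α-replicate zero    = refl
#α-replicate (suc n) = cong suc (#α-replicate n)

#β-replicate : ∀ n → #β {A} (replicate n α) ≡ 0
#β-replicate zero    = refl
#β-replicate (suc n) = #β-replicate n

-- The word starts with `β` because it describes what follows an inner vertex on a blue path, with
-- `β` for outer and `α` for inner vertices.
alternate : ℕ → List (Symbol A)
alternate 0             = []
alternate 1             = β ∷ []
alternate (suc (suc n)) = β ∷ α ∷ alternate n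

#α-alternate : ∀ n → #α {A} (alternate n) ≡ ⌊ n /2⌋
#α-alternate 0             = refl
#α-alternate 1             = refl
#α-alternate (suc (suc n)) = cong suc (#α-alternate n)

#β-alternate : ∀ n → #β {A} (alternate n) ≡ ⌈ n /2⌉
#β-alternate 0             = refl
#β-alternate 1             = refl
#β-alternate (suc (suc n)) = cong suc (#β-alternate n)

-- The star colouring

even⊎odd : ∀ n → ∃[ i ] (n ≡ i + i ⊎ n ≡ suc (i + i))
even⊎odd zero = 0 , inj₁ refl
even⊎odd (suc n) with even⊎odd n
... | i , inj₁ e = i , inj₂ (cong suc e)
... | i , inj₂ e = suc i , inj₁ (cong suc (trans e (sym (+-suc i i))))

n≤⌈n/2⌉+⌈n/2⌉ : ∀ n → n ≤ ⌈ n /2⌉ + ⌈ n /2⌉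
n≤⌈n/2⌉+⌈n/2⌉ n = subst (_≤ ⌈ n /2⌉ + ⌈ n /2⌉) (⌊n/2⌋+⌈n/2⌉≡n n) (+-monoˡ-≤ ⌈ n /2⌉ (⌊n/2⌋≤⌈n/2⌉ n))

-- Computes the second side of a blue path from an even first side. The condition `c ≤ 1` makes
-- `i + i ≤ c + (u + u)` force `i ≤ u`; one leaf at the hub gives `c = 0`, two leaves give `c = 1`.
even-rest : ∀ i u {n c} → c ≤ 1 → i + i + n ≡ c + (u + u) → i ≤ u × n ≡ c + ((u ∸ i) + (u ∸ i))
even-rest zero    u       _   eq = z≤n , eq
even-rest (suc i) zero    {n} {c} c≤1 eq = contradiction c≤1 (<⇒≱ (begin-strict
  1                   <⟨ s≤s (s≤s z≤n) ⟩
  2 + (i + i + n)     ≡⟨ cong (λ m → suc (m + n)) (+-suc i i) ⟨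
  suc i + suc i + n   ≡⟨ eq ⟩
  c + 0               ≡⟨ +-identityʳ c ⟩
  c                   ∎))
  where open ≤-Reasoning
even-rest (suc i) (suc u) {n} {c} c≤1 eq = map₁ s≤s (even-rest i u c≤1 (+-cancelˡ-≡ 2 _ _ (begin
  2 + (i + i + n)     ≡⟨ cong (λ m → suc (m + n)) (+-suc i i) ⟨
  suc i + suc i + n   ≡⟨ eq ⟩
  c + (suc u + suc u) ≡⟨ arith c u ⟩
  2 + (c + (u + u))   ∎)))
  where
  open ≡-Reasoning
  arith : ∀ c u → c + (suc u + suc u) ≡ 2 + (c + (u + u))
  arith = solve-∀

-- In use, `a` and `b` count the outer vertices on the two sides of the hub and `s` is their total
-- supply, so the conclusion contradicts the length of the path.
halves : ∀ a b {p q s} → p ≤ a + a → q ≤ b + b → a + b ≤ s → p + q ≤ s + s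
halves a b {p} {q} {s} p≤ q≤ ab≤s = begin
  p + q             ≤⟨ +-mono-≤ p≤ q≤ ⟩
  a + a + (b + b)   ≡⟨ arith a b ⟩
  a + b + (a + b)   ≤⟨ +-mono-≤ ab≤s ab≤s ⟩
  s + s             ∎
  where
  open ≤-Reasoning
  arith : ∀ a b → a + a + (b + b) ≡ a + b + (a + b)
  arith = solve-∀

odd-⌈/2⌉ : ∀ i {n} → n ≡ suc (i + i) → suc n ≤ ⌈ n /2⌉ + ⌈ n /2⌉
odd-⌈/2⌉ i refl = ≤-reflexive (begin
  2 + (i + i)     ≡⟨ cong suc (+-suc i i) ⟨
  suc i + suc i   ≡⟨ cong₂ (λ m n → suc m + suc n) (n≡⌊n+n/2⌋ i) (n≡⌊n+n/2⌋ i) ⟩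
  suc ⌊ i + i /2⌋ + suc ⌊ i + i /2⌋ ∎)
  where open ≡-Reasoning

linked-ʳ++⁻ : {R : Rel A 0ℓ} → Symmetric R → ∀ {x} xs {ys} → Linked R (xs ʳ++ x ∷ ys) →
              Linked R (x ∷ xs) × Linked R (x ∷ ys)
linked-ʳ++⁻ R-sym []       link = [-] , link
linked-ʳ++⁻ R-sym (x ∷ xs) link with l , r ∷ l′ ← linked-ʳ++⁻ R-sym xs link = R-sym r ∷ l , l′

data Vertex (e k s : ℕ) : Set where
  hub   : Vertex e k s
  leaf  : Fin e → Vertex e k s
  core  : Fin k → Vertex e k s
  outer : Fin s → Vertex e k s

-- A red clique on hub, leaves and core in which the star from the hub to the
-- leaves is made blue; the outer vertices form another red clique.
hue : ∀ {e k s} → Vertex e k s → Vertex e k s → Colour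
hue hub       (leaf _)  = blue
hue (leaf _)  hub       = blue
hue hub       (outer _) = blue
hue (leaf _)  (outer _) = blue
hue (core _)  (outer _) = blue
hue (outer _) hub       = blue
hue (outer _) (leaf _)  = blue
hue (outer _) (core _)  = blue
hue _         _         = red

hue-sym : ∀ {e k s} (a b : Vertex e k s) → hue a b ≡ hue b a
hue-sym hub       hub       = refl
hue-sym hub       (leaf _)  = refl
hue-sym hub       (core _)  = refl
hue-sym hub       (outer _) = refl
hue-sym (leaf _)  hub       = refl
hue-sym (leaf _)  (leaf _)  = refl
hue-sym (leaf _)  (core _)  = refl
hue-sym (leaf _)  (outer _) = refl
hue-sym (core _)  hub       = refl
hue-sym (core _)  (leaf _)  = refl
hue-sym (core _)  (core _)  = refl
hue-sym (core _)  (outer _) = refl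
hue-sym (outer _) hub       = refl
hue-sym (outer _) (leaf _)  = refl
hue-sym (outer _) (core _)  = refl
hue-sym (outer _) (outer _) = refl

-- With `s = t - 1`, hub, leaves and core form the red clique on `2t` vertices before recolouring,
-- and the outer vertices form the one on `t - 1`. Taking `s` as `suc u` gives a name to `t - 2`.
module Paths {e k u : ℕ} (inner-size : e + k ≡ suc (suc u + suc u)) where

  private
    s : ℕ
    s = suc u

  V : Set
  V = Vertex e k s

  -- `inner` omits the hub, which every word names explicitly.
  leaves cores inner outers : List V
  leaves = tabulate leaf
  cores  = tabulate core
  inner  = leaves ++ cores
  outers = tabulate outer

  Hue : Colour → Rel V 0ℓ
  Hue x a b = hue a b ≡ x

  leaf∈ : ∀ i → leaf i ∈ inner
  leaf∈ i = ∈-++⁺ˡ (∈-tabulate⁺ i)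

  core∈ : ∀ i → core i ∈ inner
  core∈ i = ∈-++⁺ʳ leaves (∈-tabulate⁺ i)

  core∈cores : ∀ i → core i ∈ cores
  core∈cores i = ∈-tabulate⁺ {f = core} i

  outer∈ : ∀ j → outer j ∈ outers
  outer∈ j = ∈-tabulate⁺ {f = outer} j

  length-leaves : length leaves ≡ e
  length-leaves = length-tabulate {A = V} leaf

  length-cores : length cores ≡ k
  length-cores = length-tabulate {A = V} core

  length-outers : length outers ≡ s
  length-outers = length-tabulate {A = V} outer

  length-inner : length inner ≡ suc (s + s)
  length-inner = trans (length-++ leaves) (trans (cong₂ _+_ length-leaves length-cores) inner-size)

  -- Words describing the monochromatic paths through the hub

  endWord : V → List (Symbol V)
  endWord a = the hub ∷ the a ∷ replicate (s + s) α

  -- The argument before `ʳ++` is listed from the hub outwards. The number `u + s` is `2t - 3`, the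
  -- count of vertices other than the hub and its two neighbours.
  midWord : V → V → ℕ → List (Symbol V)
  midWord a b i = (the a ∷ replicate i α) ʳ++ the hub ∷ the b ∷ replicate (u + s ∸ i) α

  -- The range `upTo s` fixes a direction: `2s - 1` vertices lie beyond the two neighbours of the
  -- hub, so exactly one side has fewer than `s` of them.
  redEnd redMid redCodes : List (List V)
  redEnd = concatMap (λ (a , M) → fill (endWord a) (leaves ++ M) []) (picks cores)
  redMid = concatMap (λ (a , M) → concatMap (λ (b , M′) → concatMap (λ i →
    fill (midWord a b i) (leaves ++ M′) []) (upTo s)) (picks M)) (picks cores)
  redCodes = redEnd ++ redMid

  oneLeafWord : V → ℕ → List (Symbol V)
  oneLeafWord l i = alternate (i + i) ʳ++ the hub ∷ the l ∷ alternate ((s ∸ i) + (s ∸ i))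

  twoLeafWord : V → V → ℕ → List (Symbol V)
  twoLeafWord l l′ i =
    (the l ∷ alternate (i + i)) ʳ++ the hub ∷ the l′ ∷ alternate (suc ((u ∸ i) + (u ∸ i)))

  -- With one leaf next to the hub, the direction is fixed by placing that leaf after the hub. With
  -- two, an odd number of vertices lies beyond them, so exactly one side is even, and it is placed
  -- first. Every word uses all `s` outer vertices.
  blueOne blueTwo blueCodes : List (List V)
  blueOne = concatMap (λ (l , L) → concatMap (λ i →
    fill (oneLeafWord l i) (L ++ cores) outers) (upTo (suc s))) (picks leaves)
  blueTwo = concatMap (λ (l , L) → concatMap (λ (l′ , L′) → concatMap (λ i →
    fill (twoLeafWord l l′ i) (L′ ++ cores) outers) (upTo s)) (picks L)) (picks leaves)
  blueCodes = blueOne ++ blueTwo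

  -- Sizes of the code lists

  length-fill′ : ∀ w (X Y : List V) {x y a b} → length X ≡ x → length Y ≡ y → #α w ≡ a → #β w ≡ b →
                 length (fill w X Y) ≡ falling x a * falling y b
  length-fill′ w X Y refl refl refl refl = length-fill w X Y

  length-without-core : ∀ M {n} → suc (length M) ≡ n → suc (length (leaves ++ M)) ≡ e + n
  length-without-core M refl = trans (cong suc (trans (length-++ leaves) (cong (_+ length M) length-leaves)))
                                   (sym (+-suc e (length M)))

  length-without-leaf : ∀ L {n} → suc (length L) ≡ n → suc (length (L ++ cores)) ≡ n + k
  length-without-leaf L refl = cong suc (trans (length-++ L) (cong (λ z → length L + z) length-cores))

  #α-alternate-even : ∀ i → #α {V} (alternate (i + i)) ≡ i
  #α-alternate-even i = trans (#α-alternate (i + i)) (sym (n≡⌊n+n/2⌋ i))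

  #β-alternate-even : ∀ i → #β {V} (alternate (i + i)) ≡ i
  #β-alternate-even i = trans (#β-alternate (i + i)) (sym (n≡⌈n+n/2⌉ i))

  #α-alternate-odd : ∀ i → #α {V} (alternate (suc (i + i))) ≡ i
  #α-alternate-odd i = trans (#α-alternate (suc (i + i))) (sym (n≡⌈n+n/2⌉ i))

  #β-alternate-odd : ∀ i → #β {V} (alternate (suc (i + i))) ≡ suc i
  #β-alternate-odd i = trans (#β-alternate (suc (i + i))) (cong suc (sym (n≡⌊n+n/2⌋ i)))

  length-redEnd : length redEnd ≡ k * (falling (s + s) (s + s) * 1)
  length-redEnd =
    length-concatMap-picks _ cores length-cores λ a M eq →
    length-fill′ (endWord a) (leaves ++ M) []
      (suc-injective (trans (length-without-core M eq) inner-size)) refl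
      (#α-replicate (s + s)) (#β-replicate (s + s))

  length-redMid : length redMid ≡ k * (pred k * (s * (falling (u + s) (u + s) * 1)))
  length-redMid =
    length-concatMap-picks _ cores length-cores λ a M eq →
    length-concatMap-picks _ M (cong pred eq) λ b M′ eq′ →
    length-concatMap-upTo (λ i → fill (midWord a b i) (leaves ++ M′) []) s λ {i} i<s →
    length-fill′ (midWord a b i) (leaves ++ M′) []
      (suc-injective (trans (length-without-core M′ eq′) (suc-injective
        (trans (sym (+-suc e _)) (trans (cong (λ n → e + suc (pred n)) (sym eq))
          (trans (cong (λ z → e + z) eq) inner-size))))))
      refl
      (trans (#α-ʳ++ (replicate i α) _)
        (trans (cong₂ _+_ (#α-replicate i) (#α-replicate (u + s ∸ i)))
          (m+[n∸m]≡n (≤-trans (<⇒≤ i<s) (m≤n+m s u)))))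
      (trans (#β-ʳ++ (replicate i α) _)
        (cong₂ _+_ (#β-replicate i) (#β-replicate (u + s ∸ i))))

  length-blueOne : length blueOne ≡ e * (suc s * (falling (s + s) s * falling s s))
  length-blueOne =
    length-concatMap-picks _ leaves length-leaves λ l L eq →
    length-concatMap-upTo (λ i → fill (oneLeafWord l i) (L ++ cores) outers) (suc s) λ {i} i≤s →
    length-fill′ (oneLeafWord l i) (L ++ cores) outers
      (suc-injective (trans (length-without-leaf L eq) inner-size))
      length-outers
      (trans (#α-ʳ++ (alternate (i + i)) _)
        (trans (cong₂ _+_ (#α-alternate-even i) (#α-alternate-even (s ∸ i)))
          (m+[n∸m]≡n (s≤s⁻¹ i≤s))))
      (trans (#β-ʳ++ (alternate (i + i)) _)
        (trans (cong₂ _+_ (#β-alternate-even i) (#β-alternate-even (s ∸ i)))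
          (m+[n∸m]≡n (s≤s⁻¹ i≤s))))

  length-blueTwo : length blueTwo ≡ e * (pred e * (s * (falling (u + s) u * falling s s)))
  length-blueTwo =
    length-concatMap-picks _ leaves length-leaves λ l L eq →
    length-concatMap-picks _ L (cong pred eq) λ l′ L′ eq′ →
    length-concatMap-upTo (λ i → fill (twoLeafWord l l′ i) (L′ ++ cores) outers) s λ {i} i<s →
    length-fill′ (twoLeafWord l l′ i) (L′ ++ cores) outers
      (suc-injective (trans (length-without-leaf L′ eq′) (suc-injective
        (trans (cong (λ n → suc (pred n + k)) (sym eq)) (trans (cong (_+ k) eq) inner-size)))))
      length-outers
      (trans (#α-ʳ++ (alternate (i + i)) _)
        (trans (cong₂ _+_ (#α-alternate-even i) (#α-alternate-odd (u ∸ i)))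
          (m+[n∸m]≡n (s≤s⁻¹ i<s))))
      (trans (#β-ʳ++ (alternate (i + i)) _)
        (trans (cong₂ _+_ (#β-alternate-even i) (#β-alternate-odd (u ∸ i)))
          (trans (+-suc i _) (cong suc (m+[n∸m]≡n (s≤s⁻¹ i<s))))))

  -- A path cut at the hub. Both sides are listed from the hub outwards, so reversing the path just
  -- exchanges `pre` and `post`.
  record Zipper (x : Colour) (pre post : List V) : Set where
    field
      uniq  : Unique (hub ∷ pre ++ post)
      left  : Linked (Hue x) (hub ∷ pre)
      right : Linked (Hue x) (hub ∷ post)
      size  : length pre + length post ≡ suc (s + s)

  open Zipper

  size-tail : ∀ {x pre b bs} → Zipper x pre (b ∷ bs) → length pre + length bs ≡ s + s
  size-tail {pre = pre} {bs = bs} z =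
    suc-injective (trans (sym (+-suc (length pre) (length bs))) (size z))

  size-tails : ∀ {x a as b bs} → Zipper x (a ∷ as) (b ∷ bs) → length as + length bs ≡ suc (u + u)
  size-tails z = suc-injective (trans (size-tail z) (cong suc (+-suc u u)))

  flip-zipper : ∀ {x pre post} → Zipper x pre post → Zipper x post pre
  flip-zipper {pre = pre} {post} z = record
    { uniq  = Unique-resp-↭ (prep hub (++-comm pre post)) (uniq z)
    ; left  = right z
    ; right = left z
    ; size  = trans (+-comm (length post) (length pre)) (size z)
    }

  unzipped : List V → List V → List V
  unzipped pre post = pre ʳ++ hub ∷ post

  unzipped-unique : ∀ pre post → Unique (hub ∷ pre ++ post) → Unique (unzipped pre post)
  unzipped-unique pre post = Unique-resp-↭ (↭-trans (↭-sym (shift hub pre post)) (++↭ʳ++ pre (hub ∷ post)))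

  Covered : List (List V) → List V → List V → Set
  Covered E pre post = unzipped pre post ∈ E ⊎ unzipped post pre ∈ E

  unique-heads : ∀ {h a b : V} {as bs} → Unique (h ∷ (a ∷ as) ++ b ∷ bs) →
    (All (a ≢_) as × All (a ≢_) bs) × a ≢ b × (All (b ≢_) as × All (b ≢_) bs)
  unique-heads {as = as} {bs} (_ ∷ a∉ ∷ uniq)
    with a∉as , a≢b ∷ a∉bs ← All.++⁻ as a∉
       | b∉ ∷ _ ← Unique-resp-↭ (shift _ as bs) uniq =
    (a∉as , a∉bs) , a≢b , All.++⁻ as b∉

  remaining-cores : ∀ {a M} → cores ↭ a ∷ M → inner ↭ a ∷ leaves ++ M
  remaining-cores {a} {M} p = ↭-trans (++⁺ˡ leaves p) (shift a leaves M)

  -- Shape of a monochromatic path on either side of the hub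

  red-stays-outer : ∀ {j zs} → Linked (Hue red) (outer j ∷ zs) → All (_∈ outers) zs
  red-stays-outer [-]                         = []
  red-stays-outer {zs = outer j ∷ _} (_ ∷ l)  = outer∈ j ∷ red-stays-outer l
  red-stays-outer {zs = hub ∷ _}     (() ∷ _)
  red-stays-outer {zs = leaf _ ∷ _}  (() ∷ _)
  red-stays-outer {zs = core _ ∷ _}  (() ∷ _)

  red-stays-inner : ∀ {a zs} → (∀ j → hue a (outer j) ≢ red) → Linked (Hue red) (a ∷ zs) →
                    All (hub ≢_) zs → All (_∈ inner) zs
  red-stays-inner {zs = []}          _ _       _        = []
  red-stays-inner {zs = hub ∷ _}     _ _       (n ∷ _)  = contradiction refl n
  red-stays-inner {zs = leaf i ∷ _}  _ (_ ∷ l) (_ ∷ ns) = leaf∈ i ∷ red-stays-inner (λ _ ()) l ns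
  red-stays-inner {zs = core i ∷ _}  _ (_ ∷ l) (_ ∷ ns) = core∈ i ∷ red-stays-inner (λ _ ()) l ns
  red-stays-inner {zs = outer j ∷ _} b (r ∷ _) _        = contradiction r (b j)

  -- The edges from the hub to leaves and outer vertices are blue, so a red path leaves it into the
  -- core, and no red edge leads from there to the outer clique.
  red-from-hub : ∀ {a zs} → Linked (Hue red) (hub ∷ a ∷ zs) → All (hub ≢_) (a ∷ zs) →
                 a ∈ cores × All (_∈ inner) zs
  red-from-hub {hub}     _       (n ∷ _)  = contradiction refl n
  red-from-hub {core i}  (_ ∷ l) (_ ∷ ns) = core∈cores i , red-stays-inner (λ _ ()) l ns
  red-from-hub {leaf _}  (() ∷ _)
  red-from-hub {outer _} (() ∷ _)

  -- Away from the hub, every blue edge joins an inner vertex to an outer one, so the path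
  -- alternates between the two sets.
  blue-after-leaf : ∀ {i zs} → Linked (Hue blue) (leaf i ∷ zs) → All (hub ≢_) zs →
                    Fits (alternate (length zs)) inner outers zs
  blue-after-core : ∀ {i zs} → Linked (Hue blue) (core i ∷ zs) → All (hub ≢_) zs →
                    Fits (alternate (length zs)) inner outers zs
  blue-from-outer : ∀ {j zs} → Linked (Hue blue) (outer j ∷ zs) → All (hub ≢_) zs →
                    Fits (alternate (suc (length zs))) inner outers (outer j ∷ zs)

  blue-after-leaf {zs = []}          _        _        = []
  blue-after-leaf {zs = hub ∷ _}     _        (n ∷ _)  = contradiction refl n
  blue-after-leaf {zs = outer j ∷ _} (_ ∷ l)  (_ ∷ ns) = blue-from-outer l ns
  blue-after-leaf {zs = leaf _ ∷ _}  (() ∷ _)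
  blue-after-leaf {zs = core _ ∷ _}  (() ∷ _)

  blue-after-core {zs = []}          _        _        = []
  blue-after-core {zs = hub ∷ _}     _        (n ∷ _)  = contradiction refl n
  blue-after-core {zs = outer j ∷ _} (_ ∷ l)  (_ ∷ ns) = blue-from-outer l ns
  blue-after-core {zs = leaf _ ∷ _}  (() ∷ _)
  blue-after-core {zs = core _ ∷ _}  (() ∷ _)

  blue-from-outer {j} {[]}          _        _        = outer∈ j ∷ []
  blue-from-outer {_} {hub ∷ _}     _        (n ∷ _)  = contradiction refl n
  blue-from-outer {j} {leaf i ∷ _}  (_ ∷ l)  (_ ∷ ns) = outer∈ j ∷ leaf∈ i ∷ blue-after-leaf l ns
  blue-from-outer {j} {core i ∷ _}  (_ ∷ l)  (_ ∷ ns) = outer∈ j ∷ core∈ i ∷ blue-after-core l ns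
  blue-from-outer {_} {outer _ ∷ _} (() ∷ _)

  -- A star edge is the only blue edge inside the first clique, so a side can break the alternation
  -- only at its first vertex.
  blue-from-hub : ∀ {zs} → Linked (Hue blue) (hub ∷ zs) → All (hub ≢_) zs →
    Fits (alternate (length zs)) inner outers zs ⊎
    ∃₂ λ i ys → zs ≡ leaf i ∷ ys × Fits (alternate (length ys)) inner outers ys
  blue-from-hub {[]}          _       _        = inj₁ []
  blue-from-hub {hub ∷ _}     _       (n ∷ _)  = contradiction refl n
  blue-from-hub {leaf i ∷ zs} (_ ∷ l) (_ ∷ ns) = inj₂ (i , zs , refl , blue-after-leaf l ns)
  blue-from-hub {outer j ∷ _} (_ ∷ l) (_ ∷ ns) = inj₁ (blue-from-outer l ns)
  blue-from-hub {core _ ∷ _}  (() ∷ _)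

  -- Every monochromatic path has a code

  red-end-covered : ∀ {post} → Zipper red [] post → unzipped [] post ∈ redEnd
  red-end-covered {[]}    z with () ← size z
  red-end-covered {a ∷ zs} z
    with h∉@(_ ∷ _) ∷ a∉ ∷ _ ← uniq z
    with a∈ , zs∈ ← red-from-hub (right z) h∉
    with M , a∈picks , p ← ∈-picks a∈ =
    ∈-concatMap _ a∈picks (subst (λ n → unzipped [] (a ∷ zs) ∈ fill (the hub ∷ the a ∷ replicate n α) (leaves ++ M) [])
      (suc-injective (size z))
      (∈-fill (the hub ∷ the a ∷ replicate (length zs) α) (uniq z)
        (refl ∷ refl ∷ fits-shrinkα (remaining-cores p) a∉ (fits-replicate zs∈))))

  red-mid-covered : ∀ {a as b bs} → Zipper red (a ∷ as) (b ∷ bs) → length as < s →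
                    unzipped (a ∷ as) (b ∷ bs) ∈ redMid
  red-mid-covered {a} {as} {b} {bs} z short
    with h∉ ∷ _ ← uniq z
    with h∉a , h∉b ← All.++⁻ (a ∷ as) h∉
    with a∈ , as∈ ← red-from-hub (left z) h∉a | b∈ , bs∈ ← red-from-hub (right z) h∉b
    with (a∉as , a∉bs) , a≢b , (b∉as , b∉bs) ← unique-heads (uniq z)
    with M , a∈picks , p ← ∈-picks a∈
    with M′ , b∈picks , p′ ← ∈-picks (∈-shrink p a≢b b∈) =
    ∈-concatMap _ a∈picks (∈-concatMap _ b∈picks
      (∈-concatMap (λ i → fill (midWord a b i) (leaves ++ M′) []) (∈-upTo⁺ short)
        (subst (λ n → unzipped (a ∷ as) (b ∷ bs) ∈
                  fill ((the a ∷ replicate (length as) α) ʳ++ the hub ∷ the b ∷ replicate n α) (leaves ++ M′) [])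
          lengths
          (∈-fill ((the a ∷ replicate (length as) α) ʳ++ the hub ∷ the b ∷ replicate (length bs) α)
            (unzipped-unique (a ∷ as) (b ∷ bs) (uniq z))
            (Pointwise.ʳ++⁺ (refl ∷ shrink p p′ a∉as b∉as (fits-replicate as∈))
              (refl ∷ refl ∷ shrink p p′ a∉bs b∉bs (fits-replicate bs∈)))))))
    where
    lengths : length bs ≡ u + s ∸ length as
    lengths = sym (m+n≡o⇒n≡o∸m′ (length as) (suc-injective (suc-injective
      (trans (cong suc (sym (+-suc (length as) (length bs)))) (size z)))))
      where
      m+n≡o⇒n≡o∸m′ : ∀ m {n o} → m + n ≡ o → o ∸ m ≡ n
      m+n≡o⇒n≡o∸m′ m {n} refl = m+n∸m≡n m n

    shrink : ∀ {M M′ zs w} → cores ↭ a ∷ M → M ↭ b ∷ M′ → All (a ≢_) zs → All (b ≢_) zs →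
             Fits w inner [] zs → Fits w (leaves ++ M′) [] zs
    shrink {M} {M′} p p′ a∉ b∉ f =
      fits-shrinkα (↭-trans (++⁺ˡ leaves p′) (shift b leaves M′)) b∉
        (fits-shrinkα (remaining-cores {a} {M} p) a∉ f)

  #β-bound-halves : ∀ w w′ p q {zs} → #β w ≡ ⌈ p /2⌉ → #β w′ ≡ ⌈ q /2⌉ → Unique zs →
                    Fits (w ʳ++ w′) inner outers zs → ⌈ p /2⌉ + ⌈ q /2⌉ ≤ s
  #β-bound-halves w w′ p q e e′ uniq fits = subst₂ _≤_
    (trans (#β-ʳ++ w w′) (cong₂ _+_ e e′)) length-outers (#β-bound (w ʳ++ w′) uniq fits)

  red-covered : ∀ {pre post} → Zipper red pre post → Covered redCodes pre post
  red-covered {[]}     {_}      z = inj₁ (∈-++⁺ˡ (red-end-covered z))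
  red-covered {_ ∷ _}  {[]}     z = inj₂ (∈-++⁺ˡ (red-end-covered (flip-zipper z)))
  red-covered {_ ∷ as} {_ ∷ bs} z with length as <? s | length bs <? s
  ... | yes p | _     = inj₁ (∈-++⁺ʳ redEnd (red-mid-covered z p))
  ... | no _  | yes q = inj₂ (∈-++⁺ʳ redEnd (red-mid-covered (flip-zipper z) q))
  -- Two sides of at least `s` vertices each exceed the `2s - 1` available.
  ... | no ¬p | no ¬q = contradiction (+-mono-≤ (≮⇒≥ ¬p) (≮⇒≥ ¬q))
    (<⇒≱ (≤-reflexive (cong suc (trans (size-tails z) (sym (+-suc u u))))))

  unique-mid : ∀ {h l : V} as bs → Unique (h ∷ as ++ l ∷ bs) → All (l ≢_) as × All (l ≢_) bs
  unique-mid as bs (_ ∷ uniq) with l∉ ∷ _ ← Unique-resp-↭ (shift _ as bs) uniq = All.++⁻ as l∉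

  blue-one-covered : ∀ {pre i bs} → Zipper blue pre (leaf i ∷ bs) →
    Fits (alternate (length pre)) inner outers pre → Fits (alternate (length bs)) inner outers bs →
    unzipped pre (leaf i ∷ bs) ∈ blueOne
  blue-one-covered {pre} {i} {bs} z fits fits′ with even⊎odd (length pre)
  ... | j , inj₁ even
    with j≤s , rest ← even-rest j s z≤n (trans (cong (_+ length bs) (sym even)) (size-tail z))
    with L , picked , p ← ∈-picks (∈-tabulate⁺ {f = leaf} i)
    with l∉pre , l∉bs ← unique-mid pre bs (uniq z) =
    ∈-concatMap _ picked (∈-concatMap (λ j → fill (oneLeafWord (leaf i) j) (L ++ cores) outers) (∈-upTo⁺ (s≤s j≤s))
      (subst₂ (λ m n → unzipped pre (leaf i ∷ bs) ∈
                 fill (alternate m ʳ++ the hub ∷ the (leaf i) ∷ alternate n) (L ++ cores) outers) even rest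
        (∈-fill _ (unzipped-unique pre (leaf i ∷ bs) (uniq z))
          (Pointwise.ʳ++⁺ (fits-shrinkα (++⁺ʳ cores p) l∉pre fits)
            (refl ∷ refl ∷ fits-shrinkα (++⁺ʳ cores p) l∉bs fits′)))))
  -- An odd side starts and ends with an outer vertex. Since `pre` and `bs` have `2s` vertices
  -- together, more than `s` outer vertices would be required.
  ... | j , inj₂ odd = contradiction
    (halves ⌈ length pre /2⌉ ⌈ length bs /2⌉ (odd-⌈/2⌉ j odd) (n≤⌈n/2⌉+⌈n/2⌉ (length bs))
      (#β-bound-halves (alternate (length pre)) _ (length pre) (length bs)
        (#β-alternate (length pre)) (#β-alternate (length bs))
        (unzipped-unique pre (leaf i ∷ bs) (uniq z)) (Pointwise.ʳ++⁺ fits (refl ∷ refl ∷ fits′))))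
    (<⇒≱ (s≤s (≤-reflexive (sym (size-tail z)))))

  blue-two-covered : ∀ {i as i′ bs} → Zipper blue (leaf i ∷ as) (leaf i′ ∷ bs) →
    Fits (alternate (length as)) inner outers as → Fits (alternate (length bs)) inner outers bs →
    ∀ j → length as ≡ j + j → unzipped (leaf i ∷ as) (leaf i′ ∷ bs) ∈ blueTwo
  blue-two-covered {i} {as} {i′} {bs} z fits fits′ j even
    with j≤u , rest ← even-rest j u ≤-refl (trans (cong (_+ length bs) (sym even)) (size-tails z))
    with (l∉as , l∉bs) , l≢l′ , (l′∉as , l′∉bs) ← unique-heads (uniq z)
    with L , picked , p ← ∈-picks (∈-tabulate⁺ {f = leaf} i)
    with L′ , picked′ , p′ ← ∈-picks (∈-shrink p l≢l′ (∈-tabulate⁺ {f = leaf} i′)) =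
    ∈-concatMap _ picked (∈-concatMap _ picked′
      (∈-concatMap (λ j → fill (twoLeafWord (leaf i) (leaf i′) j) (L′ ++ cores) outers) (∈-upTo⁺ (s≤s j≤u))
        (subst₂ (λ m n → unzipped (leaf i ∷ as) (leaf i′ ∷ bs) ∈
                   fill ((the (leaf i) ∷ alternate m) ʳ++ the hub ∷ the (leaf i′) ∷ alternate n) (L′ ++ cores) outers)
          even rest
          (∈-fill _ (unzipped-unique (leaf i ∷ as) (leaf i′ ∷ bs) (uniq z))
            (Pointwise.ʳ++⁺
              (refl ∷ fits-shrinkα (++⁺ʳ cores p′) l′∉as (fits-shrinkα (++⁺ʳ cores p) l∉as fits))
              (refl ∷ refl ∷ fits-shrinkα (++⁺ʳ cores p′) l′∉bs (fits-shrinkα (++⁺ʳ cores p) l∉bs fits′)))))))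

  blue-covered : ∀ {pre post} → Zipper blue pre post → Covered blueCodes pre post
  blue-covered {pre} {post} z
    with h∉ ∷ _ ← uniq z
    with h∉pre , h∉post ← All.++⁻ pre h∉
    with blue-from-hub (left z) h∉pre | blue-from-hub (right z) h∉post
  -- Without a star edge both sides alternate from the start, and `2s + 1` vertices around the hub
  -- would require more than `s` outer ones.
  ... | inj₁ f | inj₁ g = contradiction
    (halves ⌈ length pre /2⌉ ⌈ length post /2⌉ (n≤⌈n/2⌉+⌈n/2⌉ (length pre)) (n≤⌈n/2⌉+⌈n/2⌉ (length post))
      (#β-bound-halves (alternate (length pre)) _ (length pre) (length post)
        (#β-alternate (length pre)) (#β-alternate (length post))
        (unzipped-unique pre post (uniq z)) (Pointwise.ʳ++⁺ f (refl ∷ g))))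
    (<⇒≱ (≤-reflexive (sym (size z))))
  ... | inj₁ f | inj₂ (_ , _ , refl , g) = inj₁ (∈-++⁺ˡ (blue-one-covered z f g))
  ... | inj₂ (_ , _ , refl , f) | inj₁ g = inj₂ (∈-++⁺ˡ (blue-one-covered (flip-zipper z) g f))
  ... | inj₂ (i , as , refl , f) | inj₂ (i′ , bs , refl , g)
    with even⊎odd (length as) | even⊎odd (length bs)
  ...   | j , inj₁ e | _          = inj₁ (∈-++⁺ʳ blueOne (blue-two-covered z f g j e))
  ...   | _          | j , inj₁ e = inj₂ (∈-++⁺ʳ blueOne (blue-two-covered (flip-zipper z) g f j e))
  -- Two odd remainders would again require more than `s` outer vertices.
  ...   | m , inj₂ o | n , inj₂ o′ = contradiction
    (halves ⌈ length as /2⌉ ⌈ length bs /2⌉ (odd-⌈/2⌉ m o) (odd-⌈/2⌉ n o′)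
      (#β-bound-halves (the (leaf i) ∷ alternate (length as)) _ (length as) (length bs)
        (#β-alternate (length as)) (#β-alternate (length bs))
        (unzipped-unique (leaf i ∷ as) (leaf i′ ∷ bs) (uniq z))
        (Pointwise.ʳ++⁺ (refl ∷ f) (refl ∷ refl ∷ g))))
    (<⇒≱ (≤-reflexive (sym (size z))))

  split-at-hub : ∀ {x zs} → hub ∈ zs → Unique zs → Linked (Hue x) zs → length zs ≡ suc (suc (s + s)) →
    ∃₂ λ pre post → zs ≡ unzipped pre post × Zipper x pre post
  split-at-hub {x} hub∈ uniq link len with as , post , refl ← ∈-∃++ hub∈ =
    reverse as , post , eq , record
      { uniq  = Unique-resp-↭ (↭-trans (↭-sym (++↭ʳ++ (reverse as) (hub ∷ post))) (shift hub (reverse as) post))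
                  uniq′
      ; left  = proj₁ links
      ; right = proj₂ links
      ; size  = suc-injective (trans (sym (+-suc (length (reverse as)) (length post)))
                  (trans (sym (length-ʳ++ (reverse as))) (trans (cong length (sym eq)) len)))
      }
    where
    eq : as ++ hub ∷ post ≡ unzipped (reverse as) post
    eq = sym (trans (ʳ++-defn (reverse as)) (cong (_++ hub ∷ post) (reverse-involutive as)))

    uniq′ : Unique (unzipped (reverse as) post)
    uniq′ = subst Unique eq uniq

    links = linked-ʳ++⁻ (λ {a} {b} e → trans (hue-sym b a) e) (reverse as) (subst (Linked (Hue x)) eq link)

  unzipped-reverse : ∀ pre post → reverse (unzipped pre post) ≡ unzipped post pre
  unzipped-reverse pre post = trans (ʳ++-ʳ++ pre) (cong (λ l → post ʳ++ hub ∷ l) (++-identityʳ pre))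

  codes : Colour → List (List V)
  codes red  = redCodes
  codes blue = blueCodes

  covered : ∀ x {pre post} → Zipper x pre post → Covered (codes x) pre post
  covered red  = red-covered
  covered blue = blue-covered

  inner-short : ∀ {zs} → Unique zs → All (_∈ inner) zs → length zs ≢ suc (suc (s + s))
  inner-short uniq zs∈ len = contradiction (unique-⊆-length uniq (All.lookup zs∈))
    (<⇒≱ (≤-reflexive (trans (cong suc length-inner) (sym len))))

  alternate-short : ∀ w {zs} → Unique zs → Fits w inner outers zs → #β w ≢ suc ⌊ s + s /2⌋
  alternate-short w uniq fits eq = contradiction
    (subst₂ _≤_ (trans eq (cong suc (sym (n≡⌊n+n/2⌋ s)))) length-outers (#β-bound w uniq fits)) 1+n≰n

  -- Off the hub, a red path stays within the `2s + 1` inner or the `s` outer vertices, and a blue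
  -- one alternates, so that `2s + 2` vertices would include `s + 1` outer ones.
  without-hub : ∀ {x zs} → All (hub ≢_) zs → Unique zs → Linked (Hue x) zs → length zs ≢ suc (suc (s + s))
  without-hub {zs = hub ∷ _} (n ∷ _) _ _ _ = contradiction refl n
  without-hub {red} {outer j ∷ zs} _ uniq link len = contradiction
    (unique-⊆-length uniq (All.lookup (outer∈ j ∷ red-stays-outer link)))
    (<⇒≱ (subst₂ _<_ (sym length-outers) (sym len) (m≤n⇒m≤1+n (s≤s (m≤m+n s s)))))
  without-hub {red} {leaf i ∷ zs} (_ ∷ ns) uniq link len =
    inner-short uniq (leaf∈ i ∷ red-stays-inner (λ _ ()) link ns) len
  without-hub {red} {core i ∷ zs} (_ ∷ ns) uniq link len =
    inner-short uniq (core∈ i ∷ red-stays-inner (λ _ ()) link ns) len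
  without-hub {blue} {leaf i ∷ zs} (_ ∷ ns) uniq link len =
    alternate-short (α ∷ alternate (length zs)) uniq (leaf∈ i ∷ blue-after-leaf link ns)
      (trans (#β-alternate (length zs)) (cong ⌊_/2⌋ len))
  without-hub {blue} {core i ∷ zs} (_ ∷ ns) uniq link len =
    alternate-short (α ∷ alternate (length zs)) uniq (core∈ i ∷ blue-after-core link ns)
      (trans (#β-alternate (length zs)) (cong ⌊_/2⌋ len))
  without-hub {blue} {outer j ∷ zs} (_ ∷ ns) uniq link len =
    alternate-short (alternate (suc (length zs))) uniq (blue-from-outer link ns)
      (trans (#β-alternate (suc (length zs)))
        (trans (cong ⌈_/2⌉ len) (cong suc (trans (sym (n≡⌈n+n/2⌉ s)) (n≡⌊n+n/2⌋ s)))))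

  path-covered : ∀ {x zs} → Unique zs → Linked (Hue x) zs → length zs ≡ suc (suc (s + s)) →
                 zs ∈ codes x ⊎ reverse zs ∈ codes x
  path-covered {x} {zs} uniq link len with any⊎all {P = hub ≡_} {xs = zs} (All.tabulate λ {z} _ → hub? z)
    where
    hub? : ∀ z → hub ≡ z ⊎ hub ≢ z
    hub? hub       = inj₁ refl
    hub? (leaf _)  = inj₂ λ ()
    hub? (core _)  = inj₂ λ ()
    hub? (outer _) = inj₂ λ ()
  ... | inj₂ ∌hub = contradiction len (without-hub ∌hub uniq link)
  ... | inj₁ ∋hub with pre , post , refl , z ← split-at-hub ∋hub uniq link len =
    Sum.map₂ (subst (_∈ codes x) (sym (unzipped-reverse pre post))) (covered x z)

-- From copies of a path to sequences of vertices

unique-toList : {n : ℕ} {v : Vec A n} → Vec.Unique v → Unique (toList v)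
unique-toList []          = []
unique-toList (x∉ ∷ uniq) = Vec.toList⁺ x∉ ∷ unique-toList uniq

lookup-∷ʳ-fromℕ : ∀ {n} (v : Vec A n) x → lookup (v ∷ʳ x) (fromℕ n) ≡ x
lookup-∷ʳ-fromℕ []      x = refl
lookup-∷ʳ-fromℕ (_ ∷ v) x = lookup-∷ʳ-fromℕ v x

lookup-∷ʳ-inject₁ : ∀ {n} (v : Vec A n) x i → lookup (v ∷ʳ x) (inject₁ i) ≡ lookup v i
lookup-∷ʳ-inject₁ (_ ∷ _) x zero    = refl
lookup-∷ʳ-inject₁ (_ ∷ v) x (suc i) = lookup-∷ʳ-inject₁ v x i

lookup-reverse-opposite : ∀ {n} (v : Vec A n) i → lookup (Vec.reverse v) (opposite i) ≡ lookup v i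
lookup-reverse-opposite {n = suc n} (x ∷ v) zero =
  trans (cong (λ w → lookup w (fromℕ n)) (reverse-∷ x v)) (lookup-∷ʳ-fromℕ (Vec.reverse v) x)
lookup-reverse-opposite (x ∷ v) (suc i) =
  trans (cong (λ w → lookup w (inject₁ (opposite i))) (reverse-∷ x v))
    (trans (lookup-∷ʳ-inject₁ (Vec.reverse v) x (opposite i)) (lookup-reverse-opposite v i))

lookup-reverse : ∀ {n} (v : Vec A n) i → lookup (Vec.reverse v) i ≡ lookup v (opposite i)
lookup-reverse v i = trans (cong (lookup (Vec.reverse v)) (sym (opposite-involutive i)))
                       (lookup-reverse-opposite v (opposite i))

toℕ-opposite-step : ∀ {n} (i j : Fin n) → suc (toℕ i) ≡ toℕ j → suc (toℕ (opposite j)) ≡ toℕ (opposite i)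
toℕ-opposite-step {suc n} i j e = begin
  suc (toℕ (opposite j))    ≡⟨ cong suc (opposite-prop j) ⟩
  suc (n ∸ toℕ j)           ≡⟨ cong (λ m → suc (n ∸ m)) e ⟨
  suc (n ∸ suc (toℕ i))     ≡⟨ +-∸-assoc 1 (subst (_≤ n) (sym e) (s≤s⁻¹ (toℕ<n j))) ⟨
  suc n ∸ suc (toℕ i)       ≡⟨ opposite-prop i ⟨
  toℕ (opposite i)          ∎
  where open ≡-Reasoning

path-opposite : ∀ {n} (i j : Fin n) → Graph.Adj (path n) i j → Graph.Adj (path n) (opposite i) (opposite j)
path-opposite i j (inj₁ e) = inj₂ (toℕ-opposite-step i j e)
path-opposite i j (inj₂ e) = inj₁ (toℕ-opposite-step j i e)

-- `opposite` is an automorphism of the path, and reversing `f` precomposes it with that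
-- automorphism. A copy may therefore be coded in whichever direction is listed.
image-reverse : ∀ {k n} (f : Vec (Fin n) k) → image (path k) (Vec.reverse f) ≡ image (path k) f
image-reverse {k} {n} f = cong₂ _,_
  (tabulate-cong λ i → does-⇔ (mk⇔
    (λ (u , e) → opposite u , trans (sym (lookup-reverse f u)) e)
    (λ (u , e) → opposite u , trans (lookup-reverse-opposite f u) e))
    (vertex? (Vec.reverse f) i) (vertex? f i))
  (tabulate-cong λ i → tabulate-cong λ j → does-⇔ (mk⇔
    (λ (u , v , uv , e , e′) → opposite u , opposite v , path-opposite u v uv ,
      trans (sym (lookup-reverse f u)) e , trans (sym (lookup-reverse f v)) e′)
    (λ (u , v , uv , e , e′) → opposite u , opposite v , path-opposite u v uv ,
      trans (lookup-reverse-opposite f u) e , trans (lookup-reverse-opposite f v) e′))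
    (edge? (Vec.reverse f) i j) (edge? f i j))
  where
  vertex? : ∀ (g : Vec (Fin n) k) i → Dec (∃[ u ] lookup g u ≡ i)
  vertex? g i = any? λ u → lookup g u ≟ i

  edge? : ∀ (g : Vec (Fin n) k) i j →
          Dec (∃[ u ] ∃[ v ] Graph.Adj (path k) u v × lookup g u ≡ i × lookup g v ≡ j)
  edge? g i j = any? λ u → any? λ v →
    Graph.adj? (path k) u v ×-dec (lookup g u ≟ i) ×-dec (lookup g v ≟ j)

mono-image⇒adj : ∀ H {n} (c : Colouring n) x f → Monochromatic c x (image H f) →
                 ∀ u v → Graph.Adj H u v → Mono c x (lookup f u) (lookup f v)
mono-image⇒adj H c x f mono u v uv = mono i j (lookup⇒[]= j _
  (trans (cong (λ r → lookup r j) (lookup∘tabulate _ i))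
    (trans (lookup∘tabulate _ j) (dec-true (any? _) (u , v , uv , refl , refl)))))
  where
  i = lookup f u
  j = lookup f v

vertex : ∀ {e k s} → Fin (suc (e + (k + s))) → Vertex e k s
vertex         zero    = hub
vertex {e} {k} (suc i) = [ leaf , [ core , outer ]′ ∘ splitAt k ]′ (splitAt e i)

index : ∀ {e k s} → Vertex e k s → Fin (suc (e + (k + s)))
index             hub       = zero
index {e} {k} {s} (leaf i)  = suc (join e (k + s) (inj₁ i))
index {e} {k} {s} (core i)  = suc (join e (k + s) (inj₂ (join k s (inj₁ i))))
index {e} {k} {s} (outer i) = suc (join e (k + s) (inj₂ (join k s (inj₂ i))))

index-vertex : ∀ {e k s} (i : Fin (suc (e + (k + s)))) → index (vertex {e} {k} {s} i) ≡ i
index-vertex             zero    = refl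
index-vertex {e} {k} {s} (suc i) with splitAt e i in eq
... | inj₁ j = cong suc (trans (cong (join e (k + s)) (sym eq)) (join-splitAt e (k + s) i))
... | inj₂ j with splitAt k j in eq′
...   | inj₁ l = cong suc (trans (cong (join e (k + s) ∘ inj₂) (trans (cong (join k s) (sym eq′)) (join-splitAt k s j)))
                   (trans (cong (join e (k + s)) (sym eq)) (join-splitAt e (k + s) i)))
...   | inj₂ l = cong suc (trans (cong (join e (k + s) ∘ inj₂) (trans (cong (join k s) (sym eq′)) (join-splitAt k s j)))
                   (trans (cong (join e (k + s)) (sym eq)) (join-splitAt e (k + s) i)))

vertex-injective : ∀ {e k s} {i j : Fin (suc (e + (k + s)))} → vertex {e} {k} {s} i ≡ vertex j → i ≡ j
vertex-injective {i = i} {j} eq = trans (sym (index-vertex i)) (trans (cong index eq) (index-vertex j))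

-- In the application `n` is the Ramsey number itself, and the inequality is its upper bound
-- `3t - 1`.
module Count {e k u n : ℕ} (inner-size : e + k ≡ suc (suc u + suc u))
             (n≤ : n ≤ suc (e + (k + suc u))) where

  private
    s : ℕ
    s = suc u

  open Paths {e} {k} {u} inner-size

  embed : Fin n → V
  embed i = vertex (inject≤ i n≤)

  embed-injective : ∀ {i j} → embed i ≡ embed j → i ≡ j
  embed-injective {i} {j} eq = inject≤-injective n≤ n≤ i j (vertex-injective {e} {k} {s} eq)

  starColouring : Colouring n
  starColouring = record
    { colour     = λ i j → hue (embed i) (embed j)
    ; colour-sym = λ i j → hue-sym (embed i) (embed j)
    }

  P : Graph
  P = path (2 * suc s)

  code : Vec (Fin n) (2 * suc s) → List V
  code f = map embed (toList f)

  code-injective : ∀ {f g} → code f ≡ code g → f ≡ g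
  code-injective {f} {g} eq = trans (sym (cast-is-id refl f))
    (toList-injective refl f g (map-injective embed-injective eq))

  code-reverse : ∀ f → code (Vec.reverse f) ≡ reverse (code f)
  code-reverse f = trans (cong (map embed) (toList-reverse f)) (reverse-map embed (toList f))

  HasCode : Subgraph n → List V → Set
  HasCode S b = ∃[ f ] image P f ≡ S × code f ≡ b

  hasCode-injective : ∀ {S T b} → HasCode S b → HasCode T b → S ≡ T
  hasCode-injective (f , refl , refl) (g , refl , eq) = cong (image P) (code-injective (sym eq))

  monoCount-bound : ∀ x → monoCount P starColouring x ≤ length (codes x)
  monoCount-bound x = length-≤-via {R = HasCode} hasCode-injective
    (Unique.filter⁺ (monochromatic? starColouring x)
      (deduplicate-! _≟ˢ_ (map (image P) (injections (2 * suc s) n))))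
    (All.tabulate encode)
    where
    encode : ∀ {S} → S ∈ filter (monochromatic? starColouring x) (copies P n) →
             ∃[ b ] b ∈ codes x × HasCode S b
    encode S∈
      with S∈copies , mono ← ∈-filter⁻ (monochromatic? starColouring x) S∈
      with f , f∈ , refl ← ∈-map⁻ (image P) (∈-deduplicate⁻ _≟ˢ_ _ S∈copies)
      with path-covered {x} {code f}
             (Unique.map⁺ embed-injective (unique-toList
               (proj₂ (∈-filter⁻ unique? {xs = vectors (allFin n) (2 * suc s)} f∈))))
             (Linked.map⁺ (lookup⇒linked f λ u v e → mono-image⇒adj P starColouring x f mono u v (inj₁ e)))
             (trans (length-map embed (toList f)) (trans (length-toList f) (arith s)))
         where
         arith : ∀ s → 2 * suc s ≡ suc (suc (s + s))
         arith = solve-∀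
    ... | inj₁ f∈codes = code f , f∈codes , f , refl , refl
    ... | inj₂ r∈codes = reverse (code f) , r∈codes , Vec.reverse f , image-reverse f , code-reverse f

  m-bound : r P ≡ n → m P ≤ length redCodes + length blueCodes
  m-bound refl = ≤-trans
    (proj₂ (proj₂ (minMonoCount P (r P))) (totalMonoCount P starColouring) (starColouring , refl))
    (+-mono-≤ (monoCount-bound red) (monoCount-bound blue))

-- Arithmetic

-- The star has `e` edges and `d` is `t - e`. Taking `a` and `b` as parameters writes every size
-- without subtraction, as the ring solver requires.
module _ (a b : ℕ) where

  private
    e d u s k t N : ℕ
    e = suc a
    d = suc b
    u = a + b
    s = suc u
    -- This is `2t - 1 - e`, the number of vertices of the first clique other than the hub and the
    -- leaves.
    k = 2 + (a + (b + b))
    t = e + d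
    N = suc (e + (k + s))

    inner-size : e + k ≡ suc (s + s)
    inner-size = lemma a b
      where
      lemma : ∀ a b → suc a + (2 + (a + (b + b))) ≡ suc (suc (a + b) + suc (a + b))
      lemma = solve-∀

    open Paths {e} {k} {u} inner-size

    2t≡ : 2 * t ≡ 2 * suc s
    2t≡ = cong (2 *_) (cong suc (+-suc a b))

    r≤N : r (path (2 * suc s)) ≤ N
    r≤N = r-path-upper (suc s) (s≤s (s≤s z≤n)) (≤-reflexive (lemma a b))
      where
      lemma : ∀ a b → 3 * (2 + (a + b)) ≡ suc (suc (suc a + (2 + (a + (b + b)) + suc (a + b))))
      lemma = solve-∀

    -- `(s + s) !` unfolds to `(s + s) * F`, so all four counts are polynomial multiples of `F`.
    F = (u + s) !

    codes-total : length redCodes + length blueCodes ≡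
      k * ((s + s) * F) + k * (pred k * (s * F)) + (e * (suc s * ((s + s) * F)) + e * (pred e * (s * F)))
    codes-total = cong₂ _+_
      (trans (length-++ redEnd) (cong₂ _+_
        (trans length-redEnd (cong (k *_) (self (s + s))))
        (trans length-redMid (cong (λ n → k * (pred k * (s * n))) (self (u + s))))))
      (trans (length-++ blueOne) (cong₂ _+_
        (trans length-blueOne (cong (λ n → e * (suc s * n)) (split s s)))
        (trans length-blueTwo (cong (λ n → e * (pred e * (s * n))) (split u s)))))
      where
      self : ∀ n → falling n n * 1 ≡ n !
      self n = trans (*-identityʳ _) (falling-self n)
      split : ∀ i j → falling (i + j) i * falling j j ≡ (i + j) !
      split i j = trans (cong (falling (i + j) i *_) (falling-self j)) (falling-! i j)

  -- After division by `s * F`, the four counts add up to `k(k + 1) + e² + e(2s + 1)`. For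
  -- `k = 2s + 1 - e` this equals `(2s + 1)(2s + 2) - 2ed`.
  count-identity : 2 * (length redCodes + length blueCodes) + 2 * (e * d * (s + s) !) ≡ (2 + (s + s)) !
  count-identity = trans (cong (λ n → 2 * n + 2 * (e * d * (s + s) !)) codes-total) (lemma a b F)
    where
    lemma : ∀ a b F → let s = suc (a + b); k = 2 + (a + (b + b)) in
      2 * (k * ((s + s) * F) + k * (suc (a + (b + b)) * (s * F))
        + (suc a * (suc s * ((s + s) * F)) + suc a * (a * (s * F))))
        + 2 * (suc a * suc b * ((s + s) * F))
      ≡ (2 + (s + s)) * ((1 + (s + s)) * ((s + s) * F))
    lemma = solve-∀

  -- The bound is doubled and its negative term moved to the left, so that it can be stated in `ℕ`.
  m-upper : 2 * (m (path (2 * t)) + e * d * (2 * t ∸ 2) !) ≤ (2 * t) !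
  m-upper = begin
    2 * (m (path (2 * t)) + e * d * (2 * t ∸ 2) !)
      ≡⟨ *-distribˡ-+ 2 (m (path (2 * t))) _ ⟩
    2 * m (path (2 * t)) + 2 * (e * d * (2 * t ∸ 2) !)
      ≤⟨ +-mono-≤ (*-monoʳ-≤ 2
           (subst (λ n → m (path n) ≤ length redCodes + length blueCodes) (sym 2t≡)
             (Count.m-bound {e} {k} {u} inner-size r≤N refl)))
           (≤-reflexive (cong (λ n → 2 * (e * d * (n ∸ 2) !)) size)) ⟩
    2 * (length redCodes + length blueCodes) + 2 * (e * d * (s + s) !)
      ≡⟨ count-identity ⟩
    (2 + (s + s)) !
      ≡⟨ cong _! size ⟨
    (2 * t) ! ∎
    where
    open ≤-Reasoning
    size : 2 * t ≡ 2 + (s + s)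
    size = trans 2t≡ (lemma s)
      where
      lemma : ∀ s → 2 * suc s ≡ 2 + (s + s)
      lemma = solve-∀

-- Passage to rational numbers and the choice of the star

toℚᵘ-ι : ∀ i → toℚᵘ (ι i) ℚᵘ.≃ mkℚᵘ (+ i) 0
toℚᵘ-ι i = ℚ.toℚᵘ-fromℚᵘ (mkℚᵘ (+ i) 0)

ι-≤-minus : ∀ i j n → 2 * (i + j) ≤ n → ι i ≤ℚ + n / 2 - ι j
ι-≤-minus i j n 2i+2j≤n = begin
  ι i                     ≡⟨ ℚ.+-identityʳ (ι i) ⟨
  ι i +ℚ 0ℚ               ≡⟨ cong (ι i +ℚ_) (ℚ.+-inverseʳ (ι j)) ⟨
  ι i +ℚ (ι j - ι j)      ≡⟨ ℚ.+-assoc (ι i) (ι j) (ℚ.- ι j) ⟨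
  (ι i +ℚ ι j) - ι j      ≤⟨ ℚ.+-monoˡ-≤ (ℚ.- ι j) (ℚ.toℚᵘ-cancel-≤ sum≤) ⟩
  + n / 2 - ι j           ∎
  where
  open ℚ.≤-Reasoning
  sum≤ : toℚᵘ (ι i +ℚ ι j) ℚᵘ.≤ toℚᵘ (+ n / 2)
  sum≤ = ℚᵘ.≤-respʳ-≃ (ℚᵘ.≃-sym (ℚ.toℚᵘ-fromℚᵘ (mkℚᵘ (+ n) 1)))
    (ℚᵘ.≤-respˡ-≃ (ℚᵘ.≃-sym (ℚᵘ.≃-trans (ℚ.toℚᵘ-homo-+ (ι i) (ι j)) (ℚᵘ.+-cong (toℚᵘ-ι i) (toℚᵘ-ι j))))
      (*≤* (subst₂ ℤ._≤_
        (trans (cong +_ (*-comm 2 (i + j))) (trans (ℤ.pos-* (i + j) 2)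
          (cong (ℤ._* + 2) (sym (cong₂ ℤ._+_ (ℤ.*-identityʳ (+ i)) (ℤ.*-identityʳ (+ j)))))))
        (sym (ℤ.*-identityʳ (+ n)))
        (ℤ.+≤+ 2i+2j≤n))))

ι-≤-7/8 : ∀ i n → 16 * i ≤ 7 * n → ι i ≤ℚ (+ 7 / 8 +ℚ 0ℚ) *ℚ (+ n / 2)
ι-≤-7/8 i n 16i≤7n = subst (λ q → ι i ≤ℚ q *ℚ (+ n / 2)) (sym (ℚ.+-identityʳ (+ 7 / 8)))
  (ℚ.toℚᵘ-cancel-≤ (ℚᵘ.≤-respʳ-≃
    (ℚᵘ.≃-sym (ℚᵘ.≃-trans (ℚ.toℚᵘ-homo-* (+ 7 / 8) (+ n / 2))
      (ℚᵘ.*-congˡ {mkℚᵘ (+ 7) 7} (ℚ.toℚᵘ-fromℚᵘ (mkℚᵘ (+ n) 1)))))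
    (ℚᵘ.≤-respˡ-≃ (ℚᵘ.≃-sym (toℚᵘ-ι i))
      (*≤* (subst₂ ℤ._≤_
        (trans (cong +_ (*-comm 16 i)) (ℤ.pos-* i 16))
        (trans (ℤ.pos-* 7 n) (sym (ℤ.*-identityʳ (+ 7 ℤ.* + n))))
        (ℤ.+≤+ 16i≤7n))))))

-- The two parts of t that make the star have ⌊ t /2⌋ edges.
balanced : ∀ t → 3 ≤ t → ∃₂ λ a b → t ≡ suc a + suc b × (b ≡ a ⊎ b ≡ suc a)
balanced t 3≤t with even⊎odd t
... | zero  , inj₁ refl with () ← 3≤t
... | zero  , inj₂ refl with s≤s () ← 3≤t
... | suc a , inj₁ refl = a , a , refl , inj₁ refl
... | suc a , inj₂ refl = a , suc a , cong suc (sym (+-suc a (suc a))) , inj₂ refl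

-- With `e = suc a` and `d = suc b`, the difference of `4(ed + 1)` and `(e + d)²` is `4 - (d - e)²`,
-- which is 4 or 3.
quarter-square : ∀ a b → b ≡ a ⊎ b ≡ suc a → ((suc a + suc b) * (suc a + suc b)) div 4 ≤ suc a * suc b
quarter-square a b b≈a = ≤-pred (m<n*o⇒m/o<n {o = 4} (lemma b≈a))
  where
  lemma : b ≡ a ⊎ b ≡ suc a → (suc a + suc b) * (suc a + suc b) < suc (suc a * suc b) * 4
  lemma (inj₁ refl) = subst ((suc a + suc a) * (suc a + suc a) <_) (sym (identity a))
    (m<m+n _ (s≤s z≤n))
    where
    identity : ∀ a → suc (suc a * suc a) * 4 ≡ (suc a + suc a) * (suc a + suc a) + 4
    identity = solve-∀
  lemma (inj₂ refl) = subst ((suc a + (2 + a)) * (suc a + (2 + a)) <_) (sym (identity a))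
    (m<m+n _ (s≤s z≤n))
    where
    identity : ∀ a → suc (suc a * (2 + a)) * 4 ≡ (suc a + (2 + a)) * (suc a + (2 + a)) + 3
    identity = solve-∀

double-balanced : ∀ a b → 2 * (suc a + suc b) ≡ 2 + 2 * suc (a + b)
double-balanced = solve-∀

-- Here `n` is `2t - 2`, and `16ed = 4t² - 4(d - e)²` exceeds `2t(2t - 1)` by `2t` or `2t - 4`. This
-- slack is what permits the error term 0.
quarter-square-lower : ∀ a b → b ≡ a ⊎ b ≡ suc a →
  let n = 2 * suc (a + b) in (2 + n) * (1 + n) ≤ 16 * (suc a * suc b)
quarter-square-lower a b (inj₁ refl) = m+n≤o⇒m≤o _ (≤-reflexive (identity a))
  where
  identity : ∀ a → let n = 2 * suc (a + a) in (2 + n) * (1 + n) + (4 + 4 * a) ≡ 16 * (suc a * suc a)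
  identity = solve-∀
quarter-square-lower a b (inj₂ refl) = m+n≤o⇒m≤o _ (≤-reflexive (identity a))
  where
  identity : ∀ a → let n = 2 * suc (a + suc a) in
    (2 + n) * (1 + n) + (2 + 4 * a) ≡ 16 * (suc a * (2 + a))
  identity = solve-∀

-- By the last hypothesis `16 * w * n !` is at least `l !`. Eight times the upper bound then gives
-- `16 * i + l ! ≤ 8 * l !`.
seven-eighths : ∀ i w n {l} → l ≡ 2 + n → 2 * (i + w * (l ∸ 2) !) ≤ l ! →
                (2 + n) * (1 + n) ≤ 16 * w → 16 * i ≤ 7 * l !
seven-eighths i w n refl upper lower = +-cancelʳ-≤ ((2 + n) !) (16 * i) (7 * (2 + n) !) (begin
  16 * i + (2 + n) !                   ≡⟨ cong (λ f → 16 * i + f) (*-assoc (2 + n) (1 + n) (n !)) ⟨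
  16 * i + (2 + n) * (1 + n) * n !     ≤⟨ +-monoʳ-≤ (16 * i) (*-monoˡ-≤ (n !) lower) ⟩
  16 * i + 16 * w * n !                ≡⟨ expand i w (n !) ⟩
  8 * (2 * (i + w * n !))              ≤⟨ *-monoʳ-≤ 8 upper ⟩
  8 * (2 + n) !                        ≡⟨ +-comm ((2 + n) !) (7 * (2 + n) !) ⟩
  7 * (2 + n) ! + (2 + n) !            ∎)
  where
  open ≤-Reasoning
  expand : ∀ i w f → 16 * i + 16 * w * f ≡ 8 * (2 * (i + w * f))
  expand = solve-∀

theorem5 : (∀ t → 3 ≤ t →
    ι (m (path (2 * t))) ≤ℚ + ((2 * t) !) / 2 - ι (((t * t) div 4) * (2 * t ∸ 2) !))
    ×
    (∃[ o ] TendsToZero o ×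
    (∀ t → 3 ≤ t →
    ι (m (path (2 * t))) ≤ℚ (+ 7 / 8 +ℚ o t) *ℚ (+ ((2 * t) !) / 2)))
theorem5 = exact , (λ _ → 0ℚ) , (λ ε 0<ε → 0 , λ _ _ → 0<ε) , asymptotic
  where
  exact : ∀ t → 3 ≤ t → ι (m (path (2 * t))) ≤ℚ + ((2 * t) !) / 2 - ι (((t * t) div 4) * (2 * t ∸ 2) !)
  exact t 3≤t with a , b , refl , b≈a ← balanced t 3≤t =
    ι-≤-minus (m (path (2 * t))) (((t * t) div 4) * (2 * t ∸ 2) !) ((2 * t) !)
      (≤-trans (*-monoʳ-≤ 2 (+-monoʳ-≤ (m (path (2 * t)))
        (*-monoˡ-≤ ((2 * t ∸ 2) !) (quarter-square a b b≈a)))) (m-upper a b))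

  asymptotic : ∀ t → 3 ≤ t → ι (m (path (2 * t))) ≤ℚ (+ 7 / 8 +ℚ 0ℚ) *ℚ (+ ((2 * t) !) / 2)
  asymptotic t 3≤t with a , b , refl , b≈a ← balanced t 3≤t =
    ι-≤-7/8 (m (path (2 * t))) ((2 * t) !)
      (seven-eighths (m (path (2 * t))) (suc a * suc b) (2 * suc (a + b)) (double-balanced a b)
        (m-upper a b) (quarter-square-lower a b b≈a))
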